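{- The following categories have the dual Ramsey property: (1) the category $\mathbf{EDig}_{srq}$ whose objects are finite reflexive digraphs with linear extensions and whose morphisms are strong rigid quotient maps; (2) the category $\mathbf{EPos}_{srq}$ whose objects are finite posets with linear extensions and whose morphisms are strong rigid quotient maps.
   Context: A reflexive digraph with a linear extension is a triple $(A,\rho,\sqsubset)$ where $\rho\subseteq A^2$ is reflexive, $\sqsubset$ is a (strict) linear order on $A$, and $(x,y)\in\rho$ with $x\ne y$ implies $x\sqsubset y$. A poset with a linear extension is such a triple in which moreover $\rho$ is a partial order (reflexive, antisymmetric, transitive). Rigid surjection: a surjection $f$ between finite chains $(X,<)\to(Y,<')$ such that $\min f^{ -1}(x)<\min f^{ -1}(y)$ whenever $x<'y$. For a finite chain $(A,\sqsubset)$ and distinct $X,Y\subseteq A$ put $X\sqsubset_{alex}Y$ iff $X\subsetneq Y$, or $X,Y$ are incomparable under inclusion and $\max(X\setminus Y)\sqsubset\max(Y\setminus X)$. For a reflexive digraph with a linear extension $(A,\rho,\sqsubset)$, the set $\rho$ is linearly ordered by $\sqsubset_{sal}$: every pair $(a,a)$ precedes every pair $(a_1,a_2)$ with $a_1\neq a_2$; and if $(a_1,a_2),(b_1,b_2)\in\rho$ are both of the form $(a,a)$, or both have distinct coordinates, then $(a_1,a_2)\sqsubset_{sal}(b_1,b_2)$ iff $\{a_1,a_2\}\sqsubset_{alex}\{b_1,b_2\}$. A strong rigid quotient map from $(A,\rho,\sqsubset)$ to $(A',\rho',\sqsubset')$ is a map $f:A\to A'$ that is a homomorphism ($(x,y)\in\rho\Rightarrow(f(x),f(y))\in\rho'$)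 and such that the induced map $\hat f:(\rho,\sqsubset_{sal})\to(\rho',\sqsubset'_{sal})$, $\hat f(x,y)=(f(x),f(y))$, is a rigid surjection. A category $\mathbf C$ has the dual Ramsey property if for every integer $k\ge2$ and all objects $\mathcal A,\mathcal B$ with $\hom_{\mathbf C}(\mathcal B,\mathcal A)\neq\varnothing$ there is an object $\mathcal C$ such that for every coloring $\chi:\hom_{\mathbf C}(\mathcal C,\mathcal A)\to\{1,\ldots,k\}$ there is $w\in\hom_{\mathbf C}(\mathcal C,\mathcal B)$ such that $\chi$ is constant on $\{f\cdot w: f\in\hom_{\mathbf C}(\mathcal B,\mathcal A)\}$. -}

module Defs where

open import Level using (Level; 0ℓ; _⊔_) renaming (suc to lsuc)
open import Data.Empty using (⊥-elim)
open import Data.Nat.Base using (ℕ; _≤_)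
open import Data.Fin.Base using (Fin)
open import Data.Product using (Σ; ∃; ∃₂; ∃-syntax; _×_; _,_; proj₁; proj₂)
open import Data.Sum.Base using (_⊎_; inj₁; inj₂; [_,_]′)
open import Data.List.Base using (List; []; _∷_; map; allFin; cartesianProduct)
open import Data.List.Membership.Propositional using (_∈_; _∉_)
open import Data.List.Membership.Propositional.Properties using (∈-map⁺; ∈-allFin; ∈-cartesianProduct⁺)
open import Data.List.Relation.Unary.Any using (here; there)
open import Function.Base using (id; _∘_; case_of_)
open import Function.Bundles using (_↔_; Inverse; Func; _⟨$⟩_)
open import Function.Structures using (IsSurjection)
import Function.Construct.Composition as Comp
import Function.Construct.Identity as Ident
open import Relation.Nullary using (¬_; Dec; yes; no)
open import Relation.Unary as Pred using (Pred; _⊆_; _⊂_; _∖_; _∪_; ｛_｝)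
open import Relation.Binary
open import Relation.Binary.PropositionalEquality as ≡ using (_≡_; _≢_; refl; sym; trans; cong; cong₂; subst)

record Category (o ℓ e : Level) : Set (lsuc (o ⊔ ℓ ⊔ e)) where
  infix  4 _≈_
  infixr 9 _·_
  field
    Obj           : Set o
    Hom           : Obj → Obj → Set ℓ
    _≈_           : ∀ {A B} → Rel (Hom A B) e
    isEquivalence : ∀ {A B} → IsEquivalence (_≈_ {A} {B})
    idm           : ∀ {A} → Hom A A
    _·_           : ∀ {A B C} → Hom B C → Hom A B → Hom A C
    ·-cong        : ∀ {A B C} {f g : Hom B C} {h i : Hom A B} → f ≈ g → h ≈ i → f · h ≈ g · i
    identityˡ     : ∀ {A B} (f : Hom A B) → idm · f ≈ f
    identityʳ     : ∀ {A B} (f : Hom A B) → f · idm ≈ f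
    assoc         : ∀ {A B C D} (f : Hom C D) (g : Hom B C) (h : Hom A B) → (f · g) · h ≈ f · (g · h)

  homSetoid : Obj → Obj → Setoid ℓ e
  homSetoid A B = record { Carrier = Hom A B ; _≈_ = _≈_ ; isEquivalence = isEquivalence }

-- A colouring is a function on the hom-setoid: equal morphisms receive equal
-- colours.
HasDualRamseyProperty : ∀ {o ℓ e} → Category o ℓ e → Set (o ⊔ ℓ ⊔ e)
HasDualRamseyProperty 𝐂 =
  ∀ (k : ℕ) → 2 ≤ k → ∀ (𝒜 ℬ : Obj) → Hom ℬ 𝒜 →
  ∃[ 𝒞 ] ∀ (χ : Func (homSetoid 𝒞 𝒜) (≡.setoid (Fin k))) →
    Σ (Hom 𝒞 ℬ) λ w → ∀ (f g : Hom ℬ 𝒜) → χ ⟨$⟩ (f · w) ≡ χ ⟨$⟩ (g · w)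
  where open Category 𝐂

FullSubcategory : ∀ {o ℓ e i} (𝐂 : Category o ℓ e) {I : Set i} → (I → Category.Obj 𝐂) → Category i ℓ e
FullSubcategory 𝐂 {I} U = record
  { Obj           = I
  ; Hom           = λ A B → Hom (U A) (U B)
  ; _≈_           = _≈_
  ; isEquivalence = isEquivalence
  ; idm           = idm
  ; _·_           = _·_
  ; ·-cong        = ·-cong
  ; identityˡ     = identityˡ
  ; identityʳ     = identityʳ
  ; assoc         = assoc
  }
  where open Category 𝐂

Chain : Set₁
Chain = StrictTotalOrder 0ℓ 0ℓ 0ℓ

module _ (X : Chain) where
  open StrictTotalOrder X

  IsMin : Pred Carrier 0ℓ → Pred Carrier 0ℓ
  IsMin P m = P m × (∀ z → P z → m < z ⊎ m ≈ z)

  IsMax : Pred Carrier 0ℓ → Pred Carrier 0ℓ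
  IsMax P m = P m × (∀ z → P z → z < m ⊎ z ≈ m)

  -- The order ⊏alex on subsets of X.  In the second summand the subsets are
  -- incomparable, so both differences are nonempty.
  Alex : Rel (Pred Carrier 0ℓ) 0ℓ
  Alex P Q =
    (P ⊂ Q) ⊎
    (¬ (P ⊆ Q) × ¬ (Q ⊆ P) ×
      ∃₂ λ m n → IsMax (P ∖ Q) m × IsMax (Q ∖ P) n × m < n)

  alex-irrefl : ∀ {P} → ¬ Alex P P
  alex-irrefl (inj₁ (_ , P⊈P))     = P⊈P id
  alex-irrefl (inj₂ (P⊈P , _ , _)) = P⊈P id

  max-unique : ∀ {P m n} → IsMax P m → IsMax P n → m ≈ n
  max-unique {P} {m} {n} (Pm , m-max) (Pn , n-max) with n-max m Pm
  ... | inj₂ m≈n = m≈n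
  ... | inj₁ m<n with m-max n Pn
  ...   | inj₁ n<m = ⊥-elim (asym m<n n<m)
  ...   | inj₂ n≈m = Eq.sym n≈m

  alex-asym : ∀ {P Q} → Alex P Q → ¬ Alex Q P
  alex-asym (inj₁ (P⊆Q , _))     (inj₁ (_ , P⊈Q))     = P⊈Q P⊆Q
  alex-asym (inj₁ (P⊆Q , _))     (inj₂ (_ , P⊈Q , _)) = P⊈Q P⊆Q
  alex-asym (inj₂ (_ , Q⊈P , _)) (inj₁ (Q⊆P , _))     = Q⊈P Q⊆P
  alex-asym (inj₂ (_ , _ , m , n , mmax , nmax , m<n))
            (inj₂ (_ , _ , n′ , m′ , n′max , m′max , n′<m′)) =
    asym m<n (<-respˡ-≈ (max-unique n′max nmax) (<-respʳ-≈ (max-unique m′max mmax) n′<m′))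

-- The field rigid quantifies over least preimages.  They are unique, and they
-- exist whenever X is finite and f is surjective (for edge chains: edge-minima),
-- so the condition is min f⁻¹(x) < min f⁻¹(y) for all x < y.
record IsRigidSurjection (X Y : Chain)
    (f : StrictTotalOrder.Carrier X → StrictTotalOrder.Carrier Y) : Set where
  private
    module X = StrictTotalOrder X
    module Y = StrictTotalOrder Y

  fibre : Y.Carrier → Pred X.Carrier 0ℓ
  fibre y x = f x Y.≈ y

  field
    isSurjection : IsSurjection X._≈_ Y._≈_ f
    rigid        : ∀ {x y} → x Y.< y → ∀ {m n} →
                   IsMin X (fibre x) m → IsMin X (fibre y) n → m X.< n

  open IsSurjection isSurjection public

HasMinima : Chain → Set₁
HasMinima X = ∀ (P : Pred Carrier 0ℓ) → Pred.Decidable P → P Respects _≈_ → ∃ P → ∃ (IsMin X P)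
  where open StrictTotalOrder X

rigid-id : ∀ (X : Chain) → IsRigidSurjection X X id
rigid-id X = record
  { isSurjection = Ident.isSurjection isEquivalence
  ; rigid        = λ x<y (m≈x , _) (n≈y , _) →
                     <-respˡ-≈ (Eq.sym m≈x) (<-respʳ-≈ (Eq.sym n≈y) x<y)
  }
  where open StrictTotalOrder X

rigid-∘ : ∀ {X Y Z : Chain} → HasMinima X →
          ∀ {f g} → IsRigidSurjection Y Z f → IsRigidSurjection X Y g → IsRigidSurjection X Z (f ∘ g)
rigid-∘ {X} {Y} {Z} hasMin {f} {g} F G = record
  { isSurjection = Comp.isSurjection G.isSurjection F.isSurjection
  ; rigid        = λ x<y mMin nMin →
      G.rigid (F.rigid x<y (image-min mMin) (image-min nMin)) (fibre-min mMin) (fibre-min nMin)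
  }
  where
  module X = StrictTotalOrder X
  module Y = StrictTotalOrder Y
  module Z = StrictTotalOrder Z
  module F = IsRigidSurjection F
  module G = IsRigidSurjection G

  minOver : ∀ y → ∃ (IsMin X (G.fibre y))
  minOver y = hasMin (G.fibre y) (λ x → g x Y.≟ y)
    (λ x≈x′ gx≈y → Y.Eq.trans (G.cong (X.Eq.sym x≈x′)) gx≈y)
    (G.strictlySurjective y)

  fibre-min : ∀ {z m} → IsMin X (λ x → f (g x) Z.≈ z) m → IsMin X (G.fibre (g m)) m
  fibre-min (fgm≈z , least) =
    Y.Eq.refl , λ x gx≈gm → least x (Z.Eq.trans (F.cong gx≈gm) fgm≈z)

  image-min : ∀ {z m} → IsMin X (λ x → f (g x) Z.≈ z) m → IsMin Y (F.fibre z) (g m)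
  image-min {z} {m} mMin@(fgm≈z , least) = fgm≈z , λ y fy≈z → go y fy≈z (Y.compare (g m) y)
    where
    go : ∀ y → f y Z.≈ z → Tri (g m Y.< y) (g m Y.≈ y) (y Y.< g m) → g m Y.< y ⊎ g m Y.≈ y
    go y fy≈z (tri< lt _ _) = inj₁ lt
    go y fy≈z (tri≈ _ eq _) = inj₂ eq
    go y fy≈z (tri> _ _ gt) with minOver y
    ... | t , tMin@(gt≈y , _) with G.rigid gt tMin (fibre-min mMin) | least t (Z.Eq.trans (F.cong gt≈y) fy≈z)
    ...   | t<m | inj₁ m<t = ⊥-elim (X.asym t<m m<t)
    ...   | t<m | inj₂ m≈t = ⊥-elim (X.irrefl (X.Eq.sym m≈t) t<m)

record ExtDigraph : Set₁ where
  infix 4 _⊏_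
  field
    Carrier            : Set
    size               : ℕ
    finite             : Carrier ↔ Fin size
    ρ                  : Rel Carrier 0ℓ
    ρ?                 : Decidable ρ
    ρ-refl             : Reflexive ρ
    _⊏_                : Rel Carrier 0ℓ
    isStrictTotalOrder : IsStrictTotalOrder _≡_ _⊏_
    extends            : ∀ {x y} → ρ x y → x ≢ y → x ⊏ y

  vertexChain : Chain
  vertexChain = record { isStrictTotalOrder = isStrictTotalOrder }

  open IsStrictTotalOrder isStrictTotalOrder public
    using (compare; irrefl; asym; _≟_) renaming (trans to ⊏-trans)

  Edge : Set
  Edge = Σ (Carrier × Carrier) λ (x , y) → ρ x y

  -- ρ need not be proof-irrelevant; an element of the set ρ is the pair alone.
  infix 4 _≈ᴱ_ _⊏sal_
  _≈ᴱ_ : Rel Edge 0ℓ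
  p ≈ᴱ q = proj₁ p ≡ proj₁ q

  src tgt : Edge → Carrier
  src = proj₁ ∘ proj₁
  tgt = proj₂ ∘ proj₁

  ends : Edge → Pred Carrier 0ℓ
  ends p = ｛ src p ｝ ∪ ｛ tgt p ｝

  IsLoop : Pred Edge 0ℓ
  IsLoop p = src p ≡ tgt p

  data _⊏sal_ (p q : Edge) : Set where
    loop<nonloop : IsLoop p → ¬ IsLoop q → p ⊏sal q
    loops        : IsLoop p → IsLoop q → Alex vertexChain (ends p) (ends q) → p ⊏sal q
    nonloops     : ¬ IsLoop p → ¬ IsLoop q → Alex vertexChain (ends p) (ends q) → p ⊏sal q

  loop? : ∀ p → Dec (IsLoop p)
  loop? p = src p ≟ tgt p

  -- ⊏sal amounts to comparing, lexicographically, first whether the pair is a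
  -- loop, then the second coordinates, then the first coordinates; the lemmas
  -- below use this to show that it is a strict total order.
  Lex : Rel Edge 0ℓ
  Lex p q = tgt p ⊏ tgt q ⊎ (tgt p ≡ tgt q × src p ⊏ src q)

  loops-alex : ∀ p q → IsLoop p → IsLoop q → tgt p ⊏ tgt q → Alex vertexChain (ends p) (ends q)
  loops-alex ((a , .a) , _) ((b , .b) , _) refl refl a⊏b = inj₂
    ( (λ s → a∉ (s (inj₁ refl)))
    , (λ s → b∉ (s (inj₁ refl)))
    , a , b
    , ((inj₁ refl , a∉) , λ { z (inj₁ eq , _) → inj₂ (sym eq) ; z (inj₂ eq , _) → inj₂ (sym eq) })
    , ((inj₁ refl , b∉) , λ { z (inj₁ eq , _) → inj₂ (sym eq) ; z (inj₂ eq , _) → inj₂ (sym eq) })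
    , a⊏b )
    where
    a≢b : a ≢ b
    a≢b eq = irrefl eq a⊏b
    a∉ : ¬ (｛ b ｝ ∪ ｛ b ｝) a
    a∉ = [ a≢b ∘ sym , a≢b ∘ sym ]′
    b∉ : ¬ (｛ a ｝ ∪ ｛ a ｝) b
    b∉ = [ a≢b , a≢b ]′

  nonloops-alex : ∀ p q → src p ⊏ tgt p → src q ⊏ tgt q → Lex p q → Alex vertexChain (ends p) (ends q)
  nonloops-alex ((a₁ , a₂) , _) ((b₁ , b₂) , _) a₁⊏a₂ b₁⊏b₂ (inj₂ (refl , a₁⊏b₁)) = inj₂
    ( (λ s → a₁∉ (s (inj₁ refl)))
    , (λ s → b₁∉ (s (inj₁ refl)))
    , a₁ , b₁
    , ((inj₁ refl , a₁∉) , λ { z (inj₁ eq , _) → inj₂ (sym eq) ; z (inj₂ eq , z∉) → ⊥-elim (z∉ (inj₂ eq)) })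
    , ((inj₁ refl , b₁∉) , λ { z (inj₁ eq , _) → inj₂ (sym eq) ; z (inj₂ eq , z∉) → ⊥-elim (z∉ (inj₂ eq)) })
    , a₁⊏b₁ )
    where
    a₁∉ : ¬ (｛ b₁ ｝ ∪ ｛ b₂ ｝) a₁
    a₁∉ = [ (λ eq → irrefl (sym eq) a₁⊏b₁) , (λ eq → irrefl (sym eq) a₁⊏a₂) ]′
    b₁∉ : ¬ (｛ a₁ ｝ ∪ ｛ a₂ ｝) b₁
    b₁∉ = [ (λ eq → irrefl eq a₁⊏b₁) , (λ eq → irrefl (sym eq) b₁⊏b₂) ]′
  nonloops-alex ((a₁ , a₂) , _) ((b₁ , b₂) , _) a₁⊏a₂ b₁⊏b₂ (inj₁ a₂⊏b₂) = go (a₂ ≟ b₁)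
    where
    a₁⊏b₂ : a₁ ⊏ b₂
    a₁⊏b₂ = ⊏-trans a₁⊏a₂ a₂⊏b₂
    b₂∉ : ¬ (｛ a₁ ｝ ∪ ｛ a₂ ｝) b₂
    b₂∉ = [ (λ eq → irrefl eq a₁⊏b₂) , (λ eq → irrefl eq a₂⊏b₂) ]′
    b₂-max : IsMax vertexChain ((｛ b₁ ｝ ∪ ｛ b₂ ｝) ∖ (｛ a₁ ｝ ∪ ｛ a₂ ｝)) b₂
    b₂-max = (inj₂ refl , b₂∉) , λ { z (inj₁ refl , _) → inj₁ b₁⊏b₂ ; z (inj₂ eq , _) → inj₂ (sym eq) }
    go : Dec (a₂ ≡ b₁) → Alex vertexChain (｛ a₁ ｝ ∪ ｛ a₂ ｝) (｛ b₁ ｝ ∪ ｛ b₂ ｝)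
    go (no a₂≢b₁) = inj₂
      ( (λ s → a₂∉ (s (inj₂ refl)))
      , (λ s → b₂∉ (s (inj₂ refl)))
      , a₂ , b₂
      , ((inj₂ refl , a₂∉) , λ { z (inj₁ refl , _) → inj₁ a₁⊏a₂ ; z (inj₂ eq , _) → inj₂ (sym eq) })
      , b₂-max
      , a₂⊏b₂ )
      where
      a₂∉ : ¬ (｛ b₁ ｝ ∪ ｛ b₂ ｝) a₂
      a₂∉ = [ a₂≢b₁ ∘ sym , (λ eq → irrefl (sym eq) a₂⊏b₂) ]′
    go (yes refl) = inj₂
      ( (λ s → a₁∉ (s (inj₁ refl)))
      , (λ s → b₂∉ (s (inj₂ refl)))
      , a₁ , b₂
      , ((inj₁ refl , a₁∉) , λ { z (inj₁ eq , _) → inj₂ (sym eq) ; z (inj₂ eq , z∉) → ⊥-elim (z∉ (inj₁ eq)) })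
      , b₂-max
      , a₁⊏b₂ )
      where
      a₁∉ : ¬ (｛ a₂ ｝ ∪ ｛ b₂ ｝) a₁
      a₁∉ = [ (λ eq → irrefl (sym eq) a₁⊏a₂) , (λ eq → irrefl (sym eq) a₁⊏b₂) ]′

  nonloop⇒⊏ : ∀ p → ¬ IsLoop p → src p ⊏ tgt p
  nonloop⇒⊏ p = extends (proj₂ p)

  lex⇒sal : ∀ p q → (IsLoop p × IsLoop q) ⊎ (¬ IsLoop p × ¬ IsLoop q) → Lex p q → p ⊏sal q
  lex⇒sal p q (inj₂ (np , nq)) l =
    nonloops np nq (nonloops-alex p q (nonloop⇒⊏ p np) (nonloop⇒⊏ q nq) l)
  lex⇒sal p q (inj₁ (lp , lq)) (inj₁ t⊏t) = loops lp lq (loops-alex p q lp lq t⊏t)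
  lex⇒sal p q (inj₁ (lp , lq)) (inj₂ (t≡t , s⊏s)) =
    ⊥-elim (irrefl (trans lp (trans t≡t (sym lq))) s⊏s)

  sal-irrefl : ∀ {p q} → p ≈ᴱ q → ¬ p ⊏sal q
  sal-irrefl refl (loop<nonloop l n) = n l
  sal-irrefl refl (loops _ _ al)     = alex-irrefl vertexChain al
  sal-irrefl refl (nonloops _ _ al)  = alex-irrefl vertexChain al

  sal-asym : ∀ {p q} → p ⊏sal q → ¬ q ⊏sal p
  sal-asym (loop<nonloop lp nq) (loop<nonloop lq _) = nq lq
  sal-asym (loop<nonloop lp nq) (loops lq _ _)      = nq lq
  sal-asym (loop<nonloop lp nq) (nonloops _ np _)   = np lp
  sal-asym (loops lp lq al)     (loop<nonloop _ np) = np lp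
  sal-asym (loops lp lq al)     (loops _ _ al′)     = alex-asym vertexChain al al′
  sal-asym (loops lp lq al)     (nonloops nq _ _)   = nq lq
  sal-asym (nonloops np nq al)  (loop<nonloop lq _) = nq lq
  sal-asym (nonloops np nq al)  (loops lq _ _)      = nq lq
  sal-asym (nonloops np nq al)  (nonloops _ _ al′)  = alex-asym vertexChain al al′

  lex-connex : ∀ p q → Lex p q ⊎ p ≈ᴱ q ⊎ Lex q p
  lex-connex p q with compare (tgt p) (tgt q)
  ... | tri< lt _ _ = inj₁ (inj₁ lt)
  ... | tri> _ _ gt = inj₂ (inj₂ (inj₁ gt))
  ... | tri≈ _ eq _ with compare (src p) (src q)
  ...   | tri< lt _ _  = inj₁ (inj₂ (eq , lt))
  ...   | tri≈ _ eq′ _ = inj₂ (inj₁ (cong₂ _,_ eq′ eq))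
  ...   | tri> _ _ gt  = inj₂ (inj₂ (inj₂ (sym eq , gt)))

  sal-connex : ∀ p q → p ⊏sal q ⊎ p ≈ᴱ q ⊎ q ⊏sal p
  sal-connex p q with loop? p | loop? q
  ... | yes lp | no nq  = inj₁ (loop<nonloop lp nq)
  ... | no np  | yes lq = inj₂ (inj₂ (loop<nonloop lq np))
  ... | yes lp | yes lq with lex-connex p q
  ...   | inj₁ l        = inj₁ (lex⇒sal p q (inj₁ (lp , lq)) l)
  ...   | inj₂ (inj₁ e) = inj₂ (inj₁ e)
  ...   | inj₂ (inj₂ l) = inj₂ (inj₂ (lex⇒sal q p (inj₁ (lq , lp)) l))
  sal-connex p q | no np | no nq with lex-connex p q
  ...   | inj₁ l        = inj₁ (lex⇒sal p q (inj₂ (np , nq)) l)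
  ...   | inj₂ (inj₁ e) = inj₂ (inj₁ e)
  ...   | inj₂ (inj₂ l) = inj₂ (inj₂ (lex⇒sal q p (inj₂ (nq , np)) l))

  sal-compare : Trichotomous _≈ᴱ_ _⊏sal_
  sal-compare p q with sal-connex p q
  ... | inj₁ lt        = tri< lt (λ e → sal-irrefl e lt) (sal-asym lt)
  ... | inj₂ (inj₁ e)  = tri≈ (sal-irrefl e) e (sal-irrefl (sym e))
  ... | inj₂ (inj₂ gt) = tri> (sal-asym gt) (λ e → sal-irrefl (sym e) gt) gt

  sal⇒lex : ∀ p q → (IsLoop p × IsLoop q) ⊎ (¬ IsLoop p × ¬ IsLoop q) → p ⊏sal q → Lex p q
  sal⇒lex p q same p<q with lex-connex p q
  ... | inj₁ l        = l
  ... | inj₂ (inj₁ e) = ⊥-elim (sal-irrefl e p<q)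
  ... | inj₂ (inj₂ l) = ⊥-elim (sal-asym p<q (lex⇒sal q p (swapped same) l))
    where
    swapped : _ → (IsLoop q × IsLoop p) ⊎ (¬ IsLoop q × ¬ IsLoop p)
    swapped (inj₁ (lp , lq)) = inj₁ (lq , lp)
    swapped (inj₂ (np , nq)) = inj₂ (nq , np)

  lex-trans : ∀ p q r → Lex p q → Lex q r → Lex p r
  lex-trans p q r (inj₁ u)       (inj₁ v)        = inj₁ (⊏-trans u v)
  lex-trans p q r (inj₁ u)       (inj₂ (e , _))  = inj₁ (subst (tgt p ⊏_) e u)
  lex-trans p q r (inj₂ (e , _)) (inj₁ v)        = inj₁ (subst (_⊏ tgt r) (sym e) v)
  lex-trans p q r (inj₂ (e , u)) (inj₂ (e′ , v)) = inj₂ (trans e e′ , ⊏-trans u v)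

  sal-trans : Transitive _⊏sal_
  sal-trans (loop<nonloop lp nq)      (loop<nonloop lq _)    = ⊥-elim (nq lq)
  sal-trans (loop<nonloop lp nq)      (loops lq _ _)         = ⊥-elim (nq lq)
  sal-trans (loop<nonloop lp nq)      (nonloops _ nr _)      = loop<nonloop lp nr
  sal-trans (loops lp lq _)           (loop<nonloop _ nr)    = loop<nonloop lp nr
  sal-trans (loops lp lq _)           (nonloops nq _ _)      = ⊥-elim (nq lq)
  sal-trans (nonloops np nq _)        (loop<nonloop lq _)    = ⊥-elim (nq lq)
  sal-trans (nonloops np nq _)        (loops lq _ _)         = ⊥-elim (nq lq)
  sal-trans {p} {q} {r} u@(loops lp lq _) v@(loops _ lr _)   =
    lex⇒sal p r (inj₁ (lp , lr))
      (lex-trans p q r (sal⇒lex p q (inj₁ (lp , lq)) u) (sal⇒lex q r (inj₁ (lq , lr)) v))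
  sal-trans {p} {q} {r} u@(nonloops np nq _) v@(nonloops _ nr _) =
    lex⇒sal p r (inj₂ (np , nr))
      (lex-trans p q r (sal⇒lex p q (inj₂ (np , nq)) u) (sal⇒lex q r (inj₂ (nq , nr)) v))

  sal-respʳ : _⊏sal_ Respectsʳ _≈ᴱ_
  sal-respʳ refl (loop<nonloop l n) = loop<nonloop l n
  sal-respʳ refl (loops l l′ al)    = loops l l′ al
  sal-respʳ refl (nonloops n n′ al) = nonloops n n′ al

  sal-respˡ : _⊏sal_ Respectsˡ _≈ᴱ_
  sal-respˡ refl (loop<nonloop l n) = loop<nonloop l n
  sal-respˡ refl (loops l l′ al)    = loops l l′ al
  sal-respˡ refl (nonloops n n′ al) = nonloops n n′ al

  edgeChain : Chain
  edgeChain = record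
    { Carrier            = Edge
    ; _≈_                = _≈ᴱ_
    ; _<_                = _⊏sal_
    ; isStrictTotalOrder = record
      { isStrictPartialOrder = record
        { isEquivalence = record { refl = refl ; sym = sym ; trans = trans }
        ; irrefl        = sal-irrefl
        ; trans         = sal-trans
        ; <-resp-≈      = sal-respʳ , sal-respˡ
        }
      ; compare = sal-compare
      }
    }

  vertices : List Carrier
  vertices = map (Inverse.from finite) (allFin size)

  ∈-vertices : ∀ x → x ∈ vertices
  ∈-vertices x = subst (_∈ vertices) (Inverse.strictlyInverseʳ finite x)
    (∈-map⁺ (Inverse.from finite) (∈-allFin (Inverse.to finite x)))

  edge-minima : HasMinima edgeChain
  edge-minima P P? P-resp (e , Pe) with search (cartesianProduct vertices vertices)
    where
    Result : List (Carrier × Carrier) → Set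
    Result ps = (∀ e → P e → proj₁ e ∉ ps) ⊎
      (∃ λ m → P m × (∀ e → P e → proj₁ e ∈ ps → m ⊏sal e ⊎ m ≈ᴱ e))

    skip : ∀ {p ps} → (∀ e → P e → proj₁ e ≢ p) → Result ps → Result (p ∷ ps)
    skip no-p (inj₁ none) = inj₁ λ where
      e Pe (here eq)   → no-p e Pe eq
      e Pe (there e∈)  → none e Pe e∈
    skip no-p (inj₂ (m , Pm , least)) = inj₂ (m , Pm , λ where
      e Pe (here eq)   → ⊥-elim (no-p e Pe eq)
      e Pe (there e∈)  → least e Pe e∈)

    add : ∀ {ps} e₀ → P e₀ → Result ps → Result (proj₁ e₀ ∷ ps)
    add e₀ Pe₀ (inj₁ none) = inj₂ (e₀ , Pe₀ , λ where
      e Pe (here eq)  → inj₂ (sym eq)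
      e Pe (there e∈) → ⊥-elim (none e Pe e∈))
    add e₀ Pe₀ (inj₂ (m , Pm , least)) with sal-compare m e₀
    ... | tri< lt _ _ = inj₂ (m , Pm , λ where
      e Pe (here eq)  → inj₁ (sal-respʳ {m} {e₀} {e} (sym eq) lt)
      e Pe (there e∈) → least e Pe e∈)
    ... | tri≈ _ m≈e₀ _ = inj₂ (m , Pm , λ where
      e Pe (here eq)  → inj₂ (trans m≈e₀ (sym eq))
      e Pe (there e∈) → least e Pe e∈)
    ... | tri> _ _ gt = inj₂ (e₀ , Pe₀ , λ where
      e Pe (here eq)  → inj₂ (sym eq)
      e Pe (there e∈) → case least e Pe e∈ of λ where
        (inj₁ m<e) → inj₁ (sal-trans gt m<e)
        (inj₂ m≈e) → inj₁ (sal-respʳ {e₀} {m} {e} m≈e gt))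

    search : ∀ ps → Result ps
    search [] = inj₁ λ _ _ ()
    search ((x , y) ∷ ps) with ρ? x y
    ... | no ¬ρ = skip (λ { ((_ , _) , r) _ refl → ¬ρ r }) (search ps)
    ... | yes r with P? ((x , y) , r)
    ...   | yes Pe₀ = add ((x , y) , r) Pe₀ (search ps)
    ...   | no ¬Pe₀ = skip (λ e Pe eq → ¬Pe₀ (P-resp {e} {(x , y) , r} eq Pe)) (search ps)
  ... | inj₁ none = ⊥-elim (none e Pe (∈-cartesianProduct⁺ (∈-vertices _) (∈-vertices _)))
  ... | inj₂ (m , Pm , least) =
    m , Pm , λ z Pz → least z Pz (∈-cartesianProduct⁺ (∈-vertices _) (∈-vertices _))

module _ (𝒜 ℬ : ExtDigraph) where
  private
    module A = ExtDigraph 𝒜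
    module B = ExtDigraph ℬ

  IsHomomorphism : (A.Carrier → B.Carrier) → Set
  IsHomomorphism f = ∀ {x y} → A.ρ x y → B.ρ (f x) (f y)

  induced : (f : A.Carrier → B.Carrier) → IsHomomorphism f → A.Edge → B.Edge
  induced f hom ((x , y) , r) = (f x , f y) , hom r

  record StrongRigidQuotientMap : Set where
    field
      fun             : A.Carrier → B.Carrier
      isHomomorphism  : IsHomomorphism fun
      inducedIsRigid  : IsRigidSurjection A.edgeChain B.edgeChain (induced fun isHomomorphism)

open StrongRigidQuotientMap using (fun)

EDigsrq : Category (lsuc 0ℓ) 0ℓ 0ℓ
EDigsrq = record
  { Obj           = ExtDigraph
  ; Hom           = StrongRigidQuotientMap
  ; _≈_           = λ f g → ∀ x → fun f x ≡ fun g x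
  ; isEquivalence = record
    { refl  = λ _ → refl
    ; sym   = λ e x → sym (e x)
    ; trans = λ e e′ x → trans (e x) (e′ x)
    }
  ; idm           = λ {A} → record
    { fun            = id
    ; isHomomorphism = id
    ; inducedIsRigid = rigid-id (ExtDigraph.edgeChain A)
    }
  ; _·_           = λ {A} {B} {C} f g → record
    { fun            = fun f ∘ fun g
    ; isHomomorphism = isHomomorphism f ∘ isHomomorphism g
    ; inducedIsRigid = rigid-∘ {ExtDigraph.edgeChain A} {ExtDigraph.edgeChain B} {ExtDigraph.edgeChain C}
                         (ExtDigraph.edge-minima A) (inducedIsRigid f) (inducedIsRigid g)
    }
  ; ·-cong        = λ {_} {_} {_} {f} {g} {h} {i} f≈g h≈i x →
                      trans (cong (fun f) (h≈i x)) (f≈g (fun i x))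
  ; identityˡ     = λ _ _ → refl
  ; identityʳ     = λ _ _ → refl
  ; assoc         = λ _ _ _ _ → refl
  }
  where open StrongRigidQuotientMap

record ExtPoset : Set₁ where
  field
    digraph        : ExtDigraph
    isPartialOrder : IsPartialOrder _≡_ (ExtDigraph.ρ digraph)

EPossrq : Category (lsuc 0ℓ) 0ℓ 0ℓ
EPossrq = FullSubcategory EDigsrq ExtPoset.digraph

{-# OPTIONS --safe #-}
-- The digraph with N disjoint edges is a poset. A rigid word with N letters over
-- the edges of 𝒜, listed in the order ⊏sal, labels its edges by edges of 𝒜; reading
-- off endpoints gives a strong rigid quotient map onto 𝒜, because every endpoint of
-- an edge already occurs as a loop at an earlier or equal place of ⊏sal. Composing
-- with f : ℬ → 𝒜 amounts to composing words with the word of the induced map of f,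
-- so both claims follow from the dual Ramsey theorem for rigid surjections, i.e.
-- from the Graham–Rothschild theorem for parameter words.
--
-- Graham–Rothschild goes by induction on the number of parameters. Treating the
-- first parameter as a further letter, the induction hypothesis makes the colour
-- of a word depend only on the prefix before that parameter; Hales–Jewett makes it
-- depend only on the length of this prefix, and pigeonhole removes that dependence.
module Submission where

open import Data.Bool.Base as Bool using (Bool; true; false; f≤t; b≤b)
import Data.Bool.Properties as Bool
open import Data.Empty using (⊥-elim)
open import Data.Fin.Base as Fin using (Fin; zero; suc; toℕ; combine; funToFin; finToFun)
open import Data.Fin.Properties
  using (_≟_; toℕ<n; <-cmp; <-trans; combine-injective; finToFun-funToFin; pigeonhole; *↔×; 2↔Bool)
open import Data.List.Base as List using (List; []; _∷_; _++_; length; replicate; cartesianProduct)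
open import Data.List.Membership.Propositional using (_∈_)
open import Data.List.Membership.Propositional.Properties using (∈-cartesianProduct⁺; ∈-lookup)
open import Data.List.Relation.Binary.Pointwise.Base using (Pointwise; []; _∷_)
open import Data.List.Relation.Unary.All as All using (All; []; _∷_)
open import Data.List.Relation.Unary.AllPairs using (AllPairs; []; _∷_)
open import Data.List.Relation.Unary.Any as Any using (Any; here; there)
open import Data.List.Relation.Unary.Any.Properties using (lookup-index)
open import Data.Nat.Base as ℕ using (ℕ; zero; suc; _+_; _*_; _^_; z≤n; s≤s; z<s; s<s)
open import Data.Nat.Properties
  using (n<1+n; ≤-pred; suc-injective; +-suc; m≤m+n; m≤n+m; ≤-trans; n≤0⇒n≡0)
open import Data.Product using (Σ; ∃; _×_; _,_; proj₁; proj₂)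
open import Data.Product.Function.NonDependent.Propositional using (_×-↔_)
open import Data.Product.Relation.Binary.Lex.Strict using (×-Lex; ×-transitive; ×-compare)
open import Data.Product.Relation.Binary.Pointwise.NonDependent using (≡⇒≡×≡; ≡×≡⇒≡)
open import Data.Sum.Base using (_⊎_; inj₁; inj₂; [_,_]′)
open import Data.Unit.Base using (⊤; tt)
open import Data.Vec.Base as Vec using (Vec; []; _∷_; lookup; _[_]≔_)
open import Data.Vec.Properties using (lookup∘update; lookup∘update′; lookup-replicate)
open import Defs
open import Function.Base using (id; _∘_; const)
open import Function.Bundles using (Func; _⟨$⟩_)
open import Function.Properties.Inverse using (↔-refl; ↔-sym; ↔-trans)
open import Level using (0ℓ)
open import Relation.Binary using (Rel; StrictTotalOrder; Trichotomous; tri<; tri≈; tri>)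
open import Relation.Binary.PropositionalEquality
open import Relation.Binary.Structures.Biased using (isStrictTotalOrderᶜ)
open import Relation.Nullary using (yes; no)
open import Relation.Nullary.Decidable using (_×-dec_)

-- Parameter words

-- In Word a n k, n is the length, Fin a the alphabet and k the number of parameters.
-- The first occurrence of a parameter is a new; afterwards it is a letter of the
-- enlarged alphabet, as a de Bruijn index. Words over Fin 0 are the rigid surjections Fin n → Fin k.
data Word : ℕ → ℕ → ℕ → Set where
  []  : ∀ {a} → Word a 0 0
  old : ∀ {a n k} → Fin a → Word a n k → Word a (suc n) k
  new : ∀ {a n k} → Word (suc a) n k → Word a (suc n) (suc k)

ext : ∀ {b} {Y : Set} → (Fin b → Y) → Y → Fin (suc b) → Y
ext σ y zero    = y
ext σ y (suc x) = σ x

lift : ∀ {a b} → (Fin b → Fin a) → Fin (suc b) → Fin (suc a)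
lift σ = ext (suc ∘ σ) zero

ext-cong : ∀ {b} {Y : Set} {σ τ : Fin b → Y} (y : Y) → σ ≗ τ → ext σ y ≗ ext τ y
ext-cong y σ≗τ zero    = refl
ext-cong y σ≗τ (suc x) = σ≗τ x

∘-ext : ∀ {b} {Y Z : Set} (h : Y → Z) (σ : Fin b → Y) (y : Y) → h ∘ ext σ y ≗ ext (h ∘ σ) (h y)
∘-ext h σ y zero    = refl
∘-ext h σ y (suc x) = refl

ext∘lift : ∀ {a b} {Y : Set} (τ : Fin a → Y) (σ : Fin b → Fin a) (y : Y) →
           ext τ y ∘ lift σ ≗ ext (τ ∘ σ) y
ext∘lift τ σ y zero    = refl
ext∘lift τ σ y (suc x) = refl

lift-id : ∀ {a} → lift {a} id ≗ id
lift-id zero    = refl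
lift-id (suc x) = refl

rename : ∀ {a b n k} → (Fin a → Fin b) → Word a n k → Word b n k
rename ρ []        = []
rename ρ (old x w) = old (ρ x) (rename ρ w)
rename ρ (new w)   = new (rename (lift ρ) w)

-- The map `σ` carries the values already given to the parameters of `w`: each `new` of `w` consumes
-- one letter of `v`, and `ext σ y` or `lift σ` makes later occurrences of that parameter repeat it.
subst-word : ∀ {a b n m k} → (Fin b → Fin a) → Word b n m → Word a m k → Word a n k
subst-word σ []        []        = []
subst-word σ (old x w) v         = old (σ x) (subst-word σ w v)
subst-word σ (new w)   (old y v) = old y (subst-word (ext σ y) w v)
subst-word σ (new w)   (new v)   = new (subst-word (lift σ) w v)

infixl 7 _⊙_
_⊙_ : ∀ {a n m k} → Word a m k → Word a n m → Word a n k
v ⊙ w = subst-word id w v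

subst-cong : ∀ {a b n m k} {σ τ : Fin b → Fin a} → σ ≗ τ → (w : Word b n m) (v : Word a m k) →
             subst-word σ w v ≡ subst-word τ w v
subst-cong σ≗τ []        []        = refl
subst-cong σ≗τ (old x w) v         = cong₂ old (σ≗τ x) (subst-cong σ≗τ w v)
subst-cong σ≗τ (new w)   (old y v) = cong (old y) (subst-cong (ext-cong y σ≗τ) w v)
subst-cong σ≗τ (new w)   (new v)   = cong new (subst-cong (ext-cong zero (cong suc ∘ σ≗τ)) w v)

subst-rename : ∀ {a b c n m k} (σ : Fin b → Fin a) (ρ : Fin c → Fin b)
               (w : Word c n m) (v : Word a m k) →
               subst-word σ (rename ρ w) v ≡ subst-word (σ ∘ ρ) w v
subst-rename σ ρ []        []        = refl
subst-rename σ ρ (old x w) v         = cong (old _) (subst-rename σ ρ w v)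
subst-rename σ ρ (new w)   (old y v) =
  cong (old y) (trans (subst-rename (ext σ y) (lift ρ) w v) (subst-cong (ext∘lift σ ρ y) w v))
subst-rename σ ρ (new w)   (new v)   =
  cong new (trans (subst-rename (lift σ) (lift ρ) w v) (subst-cong (ext∘lift (suc ∘ σ) ρ zero) w v))

subst-assoc : ∀ {a b c n m l k} (τ : Fin c → Fin a) (σ : Fin b → Fin c)
              (w : Word b n m) (w′ : Word c m l) (v : Word a l k) →
              subst-word τ (subst-word σ w w′) v ≡ subst-word (τ ∘ σ) w (subst-word τ w′ v)
subst-assoc τ σ []        []         []        = refl
subst-assoc τ σ (old x w) w′         v         = cong (old _) (subst-assoc τ σ w w′ v)
subst-assoc τ σ (new w)   (old y w′) v         =
  cong (old _) (trans (subst-assoc τ (ext σ y) w w′ v) (subst-cong (∘-ext τ σ y) w _))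
subst-assoc τ σ (new w)   (new w′)   (old z v) =
  cong (old z) (trans (subst-assoc (ext τ z) (lift σ) w w′ v) (subst-cong (ext∘lift τ σ z) w _))
subst-assoc τ σ (new w)   (new w′)   (new v)   =
  cong new (trans (subst-assoc (lift τ) (lift σ) w w′ v) (subst-cong (ext∘lift (suc ∘ τ) σ zero) w _))

-- Substitution of p for the parameters, cut off before the first parameter
-- that p does not reach.
apply : ∀ {b n m} {Y : Set} → (Fin b → Y) → Word b n m → List Y → List Y
apply σ []        p       = []
apply σ (old x w) p       = σ x ∷ apply σ w p
apply σ (new w)   []      = []
apply σ (new w)   (y ∷ p) = y ∷ apply (ext σ y) w p

infix 8 _⟦_⟧
_⟦_⟧ : ∀ {a n m} → Word a n m → List (Fin a) → List (Fin a)
w ⟦ p ⟧ = apply id w p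

prefix : ∀ {a n k} → Word a n k → List (Fin a)
prefix []        = []
prefix (old x w) = x ∷ prefix w
prefix (new w)   = []

apply-cong : ∀ {b n m} {Y : Set} {σ τ : Fin b → Y} → σ ≗ τ → (w : Word b n m) (p : List Y) →
             apply σ w p ≡ apply τ w p
apply-cong σ≗τ []        p       = refl
apply-cong σ≗τ (old x w) p       = cong₂ _∷_ (σ≗τ x) (apply-cong σ≗τ w p)
apply-cong σ≗τ (new w)   []      = refl
apply-cong σ≗τ (new w)   (y ∷ p) = cong (y ∷_) (apply-cong (ext-cong y σ≗τ) w p)

apply-rename : ∀ {b c n m} {Y : Set} (σ : Fin b → Y) (ρ : Fin c → Fin b)
               (w : Word c n m) (p : List Y) → apply σ (rename ρ w) p ≡ apply (σ ∘ ρ) w p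
apply-rename σ ρ []        p       = refl
apply-rename σ ρ (old x w) p       = cong (_ ∷_) (apply-rename σ ρ w p)
apply-rename σ ρ (new w)   []      = refl
apply-rename σ ρ (new w)   (y ∷ p) =
  cong (y ∷_) (trans (apply-rename (ext σ y) (lift ρ) w p) (apply-cong (ext∘lift σ ρ y) w p))

apply-map : ∀ {b n m} {Y Z : Set} (h : Y → Z) (σ : Fin b → Y) (w : Word b n m) (p : List Y) →
            apply (h ∘ σ) w (List.map h p) ≡ List.map h (apply σ w p)
apply-map h σ []        p       = refl
apply-map h σ (old x w) p       = cong (_ ∷_) (apply-map h σ w p)
apply-map h σ (new w)   []      = refl
apply-map h σ (new w)   (y ∷ p) =
  cong (_ ∷_) (trans (sym (apply-cong (∘-ext h σ y) w _)) (apply-map h (ext σ y) w p))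

apply-subst : ∀ {b c n m l} {Y : Set} (τ : Fin c → Y) (σ : Fin b → Fin c)
              (w : Word b n m) (v : Word c m l) (p : List Y) →
              apply τ (subst-word σ w v) p ≡ apply (τ ∘ σ) w (apply τ v p)
apply-subst τ σ []        []        p       = refl
apply-subst τ σ (old x w) v         p       = cong (_ ∷_) (apply-subst τ σ w v p)
apply-subst τ σ (new w)   (old y v) p       =
  cong (_ ∷_) (trans (apply-subst τ (ext σ y) w v p) (apply-cong (∘-ext τ σ y) w _))
apply-subst τ σ (new w)   (new v)   []      = refl
apply-subst τ σ (new w)   (new v)   (z ∷ p) =
  cong (z ∷_) (trans (apply-subst (ext τ z) (lift σ) w v p) (apply-cong (ext∘lift τ σ z) w _))

-- The cut-off in `apply` falls exactly where the first `new` of `v` surfaces in the composite. A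
-- colouring read off prefixes can therefore be refined by composing with `w`.
prefix-subst : ∀ {a b n m k} (σ : Fin b → Fin a) (w : Word b n m) (v : Word a m k) →
               prefix (subst-word σ w v) ≡ apply σ w (prefix v)
prefix-subst σ []        []        = refl
prefix-subst σ (old x w) v         = cong (_ ∷_) (prefix-subst σ w v)
prefix-subst σ (new w)   (old y v) = cong (y ∷_) (prefix-subst (ext σ y) w v)
prefix-subst σ (new w)   (new v)   = refl

length-apply : ∀ {b n m} {Y : Set} (σ : Fin b → Y) (w : Word b n m) (p : List Y) →
               length (apply σ w p) ℕ.≤ n
length-apply σ []        p       = z≤n
length-apply σ (old x w) p       = s≤s (length-apply σ w p)
length-apply σ (new w)   []      = z≤n
length-apply σ (new w)   (y ∷ p) = s≤s (length-apply (ext σ y) w p)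

length-prefix : ∀ {a n} (v : Word a n 0) → length (prefix v) ≡ n
length-prefix []        = refl
length-prefix (old x v) = cong suc (length-prefix v)

infixr 6 _⧺_
_⧺_ : ∀ {a n m k l} → Word a n k → Word a m l → Word a (n + m) (k + l)
[]      ⧺ u = u
old x w ⧺ u = old x (w ⧺ u)
new w   ⧺ u = new (w ⧺ rename suc u)

apply-⧺ : ∀ {b n m k l} {Y : Set} (σ : Fin b → Y) (w : Word b n k) (u : Word b m l)
          (p q : List Y) → length p ≡ k → apply σ (w ⧺ u) (p ++ q) ≡ apply σ w p ++ apply σ u q
apply-⧺ σ []        u []      q eq   = refl
apply-⧺ σ (old x w) u p       q eq   = cong (_ ∷_) (apply-⧺ σ w u p q eq)
apply-⧺ σ (new w)   u (y ∷ p) q eq   = cong (y ∷_)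
  (trans (apply-⧺ (ext σ y) w (rename suc u) p q (suc-injective eq))
         (cong (apply (ext σ y) w p ++_) (apply-rename (ext σ y) suc u q)))

apply-⧺-[] : ∀ {b n m k l} {Y : Set} (σ : Fin b → Y) (w : Word b n (suc k)) (u : Word b m l) →
             apply σ (w ⧺ u) [] ≡ apply σ w []
apply-⧺-[] σ (old x w) u = cong (_ ∷_) (apply-⧺-[] σ w u)
apply-⧺-[] σ (new w)   u = refl

constant : ∀ {a} n → Fin a → Word a n 0
constant zero    x = []
constant (suc n) x = old x (constant n x)

-- The letter `x` pads short lists and surplus letters are dropped, so a colouring of words induces
-- one of all lists.
fromList : ∀ {a} n → Fin a → List (Fin a) → Word a n 0
fromList zero    x p       = []
fromList (suc n) x []      = constant (suc n) x
fromList (suc n) x (y ∷ p) = old y (fromList n x p)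

fromList-prefix : ∀ {a n} (x : Fin a) (v : Word a n 0) → fromList n x (prefix v) ≡ v
fromList-prefix x []        = refl
fromList-prefix x (old y v) = cong (old y) (fromList-prefix x v)

-- The Hales–Jewett theorem

funToFin-injective : ∀ {m n} (f g : Fin m → Fin n) → funToFin f ≡ funToFin g → f ≗ g
funToFin-injective f g eq x =
  trans (sym (finToFun-funToFin f x)) (trans (cong (λ c → finToFun c x) eq) (finToFun-funToFin g x))

-- The number of `r`-colourings of the lists of length at most `n` over `a` letters: a colour for
-- the empty list and, for each first letter, a colouring of the tails.
profiles : ℕ → ℕ → ℕ → ℕ
profiles a r zero    = r
profiles a r (suc n) = r * profiles a r n ^ a

profile : ∀ {a r} n → (List (Fin a) → Fin r) → Fin (profiles a r n)
profile zero    f = f []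
profile (suc n) f = combine (f []) (funToFin (λ x → profile n (f ∘ (x ∷_))))

profile-injective : ∀ {a r} n (f g : List (Fin a) → Fin r) → profile n f ≡ profile n g →
                    ∀ p → length p ℕ.≤ n → f p ≡ g p
profile-injective zero    f g eq []      _         = eq
profile-injective (suc n) f g eq []      _         = proj₁ (combine-injective (f []) _ (g []) _ eq)
profile-injective (suc n) f g eq (x ∷ p) (s≤s p≤n) = profile-injective n (f ∘ (x ∷_)) (g ∘ (x ∷_))
  (funToFin-injective _ _ (proj₂ (combine-injective (f []) _ (g []) _ eq)) x) p p≤n

-- The relation `E` tells which letters the colour must not distinguish: `Total` for Hales-Jewett,
-- `SameZero` within its induction. In `SpaceProperty` the lists may be shorter than `d`; `apply`
-- then cuts `w` off, which later gives control over prefixes.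
LineProperty SpaceProperty : ∀ {a} → Rel (Fin a) 0ℓ → Set
LineProperty {a} E = ∀ r → ∃ λ N → ∀ (χ : List (Fin a) → Fin r) →
  Σ (Word a N 1) λ w → ∀ x y → E x y → χ (w ⟦ x ∷ [] ⟧) ≡ χ (w ⟦ y ∷ [] ⟧)
SpaceProperty {a} E = ∀ d r → ∃ λ N → ∀ (χ : List (Fin a) → Fin r) →
  Σ (Word a N d) λ w → ∀ p q → Pointwise E p q → χ (w ⟦ p ⟧) ≡ χ (w ⟦ q ⟧)

-- The second block only has to serve the a words of the line ℓ, so its length N₂ does
-- not depend on N₁; ℓ is then chosen to serve all words of length at most N₂.
line⇒space : ∀ {a} {E : Rel (Fin a) 0ℓ} → LineProperty E → SpaceProperty E
line⇒space line zero r = 0 , λ χ → [] , λ _ _ _ → refl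
line⇒space {a} {E} line (suc d) r = N₁ + N₂ , λ χ →
  let ℓ , ℓ-insensitive = block₁ (λ u → profile N₂ (χ ∘ (u ++_)))
      w , w-insensitive = block₂ (λ u → funToFin (λ x → χ (ℓ ⟦ x ∷ [] ⟧ ++ u)))
      open ≡-Reasoning
  in ℓ ⧺ w , λ where
      []      []      []          → refl
      (x ∷ p) (y ∷ q) (xEy ∷ pEq) → begin
        χ ((ℓ ⧺ w) ⟦ x ∷ p ⟧)            ≡⟨ cong χ (apply-⧺ id ℓ w (x ∷ []) p refl) ⟩
        χ (ℓ ⟦ x ∷ [] ⟧ ++ w ⟦ p ⟧)      ≡⟨ funToFin-injective _ _ (w-insensitive p q pEq) x ⟩
        χ (ℓ ⟦ x ∷ [] ⟧ ++ w ⟦ q ⟧)      ≡⟨ profile-injective N₂ (χ ∘ (ℓ ⟦ x ∷ [] ⟧ ++_)) _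
                                              (ℓ-insensitive x y xEy) (w ⟦ q ⟧) (length-apply id w q) ⟩
        χ (ℓ ⟦ y ∷ [] ⟧ ++ w ⟦ q ⟧)      ≡⟨ cong χ (apply-⧺ id ℓ w (y ∷ []) q refl) ⟨
        χ ((ℓ ⧺ w) ⟦ y ∷ q ⟧)            ∎
  where
  N₂ = proj₁ (line⇒space line d (r ^ a))
  block₂ = proj₂ (line⇒space line d (r ^ a))
  N₁ = proj₁ (line (profiles a r N₂))
  block₁ = proj₂ (line (profiles a r N₂))

Total : ∀ {a} → Rel (Fin a) 0ℓ
Total _ _ = ⊤

data SameZero {a} : Rel (Fin (suc a)) 0ℓ where
  zeros    : SameZero zero zero
  nonzeros : ∀ {x y} → SameZero (suc x) (suc y)

-- A monochromatic line for the smaller alphabet is moved to the nonzero letters; `zero` is compared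
-- with itself only.
sameZero-line : ∀ {a} → LineProperty (Total {a}) → LineProperty (SameZero {a})
sameZero-line line r = proj₁ (line r) , λ χ →
  let w , w-mono = proj₂ (line r) (χ ∘ List.map suc)
      apply-suc : ∀ x → List.map suc (w ⟦ x ∷ [] ⟧) ≡ rename suc w ⟦ suc x ∷ [] ⟧
      apply-suc x = trans (sym (apply-map suc id w (x ∷ []))) (sym (apply-rename id suc w (suc x ∷ [])))
  in rename suc w , λ where
      _       _       zeros    → refl
      (suc x) (suc y) nonzeros →
        trans (cong χ (sym (apply-suc x))) (trans (w-mono x y tt) (cong χ (apply-suc y)))

step : ∀ {a} → ℕ → ℕ → List (Fin (suc (suc a)))
step zero    i       = []
step (suc n) zero    = suc zero ∷ step n zero
step (suc n) (suc i) = zero ∷ step n i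

-- The word 0 … 0 μ … μ 1 … 1, where the parameter μ occupies the places i, …, j - 1:
-- it becomes step n j for μ = 0 and, up to nonzero letters, step n i for μ ≠ 0.
stepWord : ∀ {a} n i j → i ℕ.< j → j ℕ.≤ n → Word (suc (suc a)) n 1
stepWord (suc n) (suc i) (suc j) (s≤s i<j) (s≤s j≤n) = old zero (stepWord n i j i<j j≤n)
stepWord (suc n) zero    (suc j) _         _         = new (fromList n (suc (suc zero)) (replicate j zero))

step-zero : ∀ {a} n i j (i<j : i ℕ.< j) (j≤n : j ℕ.≤ n) →
            stepWord {a} n i j i<j j≤n ⟦ zero ∷ [] ⟧ ≡ step n j
step-zero (suc n) (suc i) (suc j) (s≤s i<j) (s≤s j≤n) = cong (zero ∷_) (step-zero n i j i<j j≤n)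
step-zero {a} (suc n) zero (suc j) _ _ = cong (zero ∷_) (go n j)
  where
  ones : ∀ n → apply (ext id zero) (constant n (suc (suc zero))) [] ≡ step {a} n zero
  ones zero    = refl
  ones (suc n) = cong (_ ∷_) (ones n)
  go : ∀ n j → apply (ext id zero) (fromList n (suc (suc zero)) (replicate j zero)) [] ≡ step {a} n j
  go zero    j       = refl
  go (suc n) zero    = ones (suc n)
  go (suc n) (suc j) = cong (zero ∷_) (go n j)

step-suc : ∀ {a} n i j (i<j : i ℕ.< j) (j≤n : j ℕ.≤ n) (x : Fin (suc a)) →
           Pointwise SameZero (stepWord n i j i<j j≤n ⟦ suc x ∷ [] ⟧) (step n i)
step-suc (suc n) (suc i) (suc j) (s≤s i<j) (s≤s j≤n) x = zeros ∷ step-suc n i j i<j j≤n x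
step-suc {a} (suc n) zero (suc j) _ _ x = nonzeros ∷ go n j
  where
  ones : ∀ n → Pointwise SameZero (apply (ext id (suc x)) (constant n (suc (suc zero))) []) (step {a} n zero)
  ones zero    = []
  ones (suc n) = nonzeros ∷ ones n
  go : ∀ n j → Pointwise SameZero
         (apply (ext id (suc x)) (fromList n (suc (suc zero)) (replicate j zero)) []) (step {a} n zero)
  go zero    j       = []
  go (suc n) zero    = ones (suc n)
  go (suc n) (suc j) = nonzeros ∷ go n j

-- In a space where the colour ignores which nonzero letter is used, two of the r + 1
-- steps have the same colour, and the step word between them is a monochromatic line.
extend-alphabet : ∀ {a} → LineProperty (Total {suc a}) → LineProperty (Total {suc (suc a)})
extend-alphabet {a} line r = proj₁ space , λ χ → fill χ (proj₂ space χ)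
  where
  space = line⇒space (sameZero-line line) r r

  fill : ∀ {N} χ →
         (Σ (Word (suc (suc a)) N r) λ w → ∀ p q → Pointwise SameZero p q → χ (w ⟦ p ⟧) ≡ χ (w ⟦ q ⟧)) →
         Σ (Word (suc (suc a)) N 1) λ w → ∀ x y → ⊤ → χ (w ⟦ x ∷ [] ⟧) ≡ χ (w ⟦ y ∷ [] ⟧)
  fill χ (w , insensitive) with pigeonhole (n<1+n r) (λ i → χ (w ⟦ step r (toℕ i) ⟧))
  ... | i , j , i<j , eq = ℓ ⊙ w , λ x y _ → trans (colour x) (sym (colour y))
    where
    j≤r : toℕ j ℕ.≤ r
    j≤r = ≤-pred (toℕ<n j)
    ℓ : Word (suc (suc a)) r 1
    ℓ = stepWord r (toℕ i) (toℕ j) i<j j≤r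
    colour-ℓ : ∀ x → χ (w ⟦ ℓ ⟦ x ∷ [] ⟧ ⟧) ≡ χ (w ⟦ step r (toℕ i) ⟧)
    colour-ℓ zero    = trans (cong (χ ∘ (w ⟦_⟧)) (step-zero r (toℕ i) (toℕ j) i<j j≤r)) (sym eq)
    colour-ℓ (suc x) = insensitive _ _ (step-suc r (toℕ i) (toℕ j) i<j j≤r x)
    colour : ∀ x → χ ((ℓ ⊙ w) ⟦ x ∷ [] ⟧) ≡ χ (w ⟦ step r (toℕ i) ⟧)
    colour x = trans (cong χ (apply-subst id id w ℓ (x ∷ []))) (colour-ℓ x)

hales-jewett : ∀ a → LineProperty (Total {a})
hales-jewett zero          r = 1 , λ χ → new [] , λ ()
hales-jewett (suc zero)    r = 1 , λ χ → new [] , λ { zero zero _ → refl }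
hales-jewett (suc (suc a)) = extend-alphabet (hales-jewett (suc a))

-- Pigeonhole on the lengths of prefixes

replicate-total : ∀ {a} (x : Fin a) (p : List (Fin a)) → Pointwise Total p (replicate (length p) x)
replicate-total x []      = []
replicate-total x (y ∷ p) = tt ∷ replicate-total x p

sum-update : ∀ {r} (D : Vec ℕ r) i {d} → lookup D i ≡ suc d → Vec.sum D ≡ suc (Vec.sum (D [ i ]≔ d))
sum-update (_ ∷ D) zero    refl = refl
sum-update (e ∷ D) (suc i) eq   = trans (cong (e +_) (sum-update D i eq)) (+-suc e _)

level : ∀ {a n k} → Word a n k → ℕ
level = length ∘ prefix

lookup≤sum : ∀ {r} (D : Vec ℕ r) i → lookup D i ℕ.≤ Vec.sum D
lookup≤sum (d ∷ D) zero    = m≤m+n d _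
lookup≤sum (d ∷ D) (suc i) = ≤-trans (lookup≤sum D i) (m≤n+m _ d)

-- Pigeonhole with a separate demand D i for every colour i.
monochromatic-levels : ∀ {a r} → Fin a → ∀ N (D : Vec ℕ r) → Vec.sum D ≡ N → (c : ℕ → Fin r) →
  Σ (Fin r) λ i → Σ (Word a N (lookup D i)) λ w →
    ∀ {k} (v : Word a (lookup D i) (suc k)) → c (level (v ⊙ w)) ≡ i
monochromatic-levels {a} {r} x zero D ∑D≡0 c = c 0 , subst P (sym D≡0) ([] , λ ())
  where
  P = λ d → Σ (Word a 0 d) λ w → ∀ {k} (v : Word a d (suc k)) → c (level (v ⊙ w)) ≡ c 0
  D≡0 : lookup D (c 0) ≡ 0
  D≡0 = n≤0⇒n≡0 (subst (lookup D (c 0) ℕ.≤_) ∑D≡0 (lookup≤sum D (c 0)))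
monochromatic-levels {a} {r} x (suc N) D ∑D≡sN c = go (lookup D (c 0)) refl
  where
  Goal = λ i d → Σ (Word a (suc N) d) λ w → ∀ {k} (v : Word a d (suc k)) → c (level (v ⊙ w)) ≡ i
  -- Level 0 has colour `c 0`. If its demand is zero, a word without parameters satisfies the claim
  -- vacuously. Otherwise its demand is lowered by one and the later levels are treated recursively;
  -- a parameter is put in front if the colour found is `c 0`, and a letter if not.
  go : ∀ d → lookup D (c 0) ≡ d → Σ (Fin r) λ i → Goal i (lookup D i)
  go zero    D≡0 = c 0 , subst (Goal (c 0)) (sym D≡0) (constant (suc N) x , λ ())
  go (suc d) D≡d with monochromatic-levels {a} x N (D [ c 0 ]≔ d)
                        (suc-injective (trans (sym (sum-update D (c 0) D≡d)) ∑D≡sN)) (c ∘ suc)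
  ... | i , w , mono with i ≟ c 0
  ...   | no i≢c₀ = i , subst (Goal i) (lookup∘update′ i≢c₀ D d) (old x w , mono)
  ...   | yes refl = i , subst (Goal i) (sym D≡d) (extend (subst P (lookup∘update i D d) (w , mono)))
    where
    P = λ e → Σ (Word a N e) λ w → ∀ {k} (v : Word a e (suc k)) → c (suc (level (v ⊙ w))) ≡ i
    extend : P d → Goal i (suc d)
    extend (w , mono) = new (rename suc w) , λ where
      (new v)   → refl
      (old y v) → trans (cong (c ∘ suc ∘ level) (subst-rename (ext id y) suc w v)) (mono v)

-- The Graham–Rothschild theorem

-- The alphabet `suc a` provides a letter for padding. The given colour serves as `c` when no word
-- `v` exists.
GrahamRothschild : ℕ → Set
GrahamRothschild k = ∀ a m r → Fin r → ∃ λ N → ∀ (χ : Word (suc a) N k → Fin r) →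
  Σ (Fin r) λ c → Σ (Word (suc a) N m) λ w → ∀ v → χ (v ⊙ w) ≡ c

-- u serves the words that begin with a parameter; w serves all words that begin with
-- a letter x at once, by colouring with functions of x.
prefix-determined : ∀ {k} → GrahamRothschild k → ∀ a M r → Fin r →
  ∃ λ N → ∀ (χ : Word (suc a) N (suc k) → Fin r) →
    Σ (List (Fin (suc a)) → Fin r) λ f → Σ (Word (suc a) N M) λ w → ∀ v → χ (v ⊙ w) ≡ f (prefix v)
prefix-determined GR a zero    r c₀ = 0 , λ χ → const c₀ , [] , λ ()
prefix-determined {k} GR a (suc M) r c₀ = suc N , λ χ →
  let c , u , u-mono = ramsey (χ ∘ new)
      f , w , w-det  = rest (λ v → funToFin (λ x → χ (old x (subst-word (ext id x) u v))))
  -- After its first place, the leading parameter recurs only inside `u`, since `w` is renamed past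
  -- it. Replacing it by a letter `x` thus changes how `u` is read but leaves `w` intact.
  in (λ { [] → c ; (x ∷ p) → finToFun (f p) x }) , new (rename suc w ⊙ u) , λ where
      (new v)   → trans
        (cong (χ ∘ new) (trans (subst-cong lift-id (rename suc w ⊙ u) v)
                               (subst-assoc id id u (rename suc w) v)))
        (u-mono (v ⊙ rename suc w))
      (old x v) → begin
        χ (old x (subst-word (ext id x) (rename suc w ⊙ u) v))
          ≡⟨ cong (χ ∘ old x) (subst-assoc (ext id x) id u (rename suc w) v) ⟩
        χ (old x (subst-word (ext id x) u (subst-word (ext id x) (rename suc w) v)))
          ≡⟨ cong (χ ∘ old x ∘ subst-word (ext id x) u) (subst-rename (ext id x) suc w v) ⟩
        χ (old x (subst-word (ext id x) u (v ⊙ w)))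
          ≡⟨ finToFun-funToFin (λ x → χ (old x (subst-word (ext id x) u (v ⊙ w)))) x ⟨
        finToFun (funToFin (λ x → χ (old x (subst-word (ext id x) u (v ⊙ w))))) x
          ≡⟨ cong (λ c → finToFun c x) (w-det v) ⟩
        finToFun (f (prefix v)) x ∎
  where
  open ≡-Reasoning
  M′ = proj₁ (prefix-determined GR a M (r ^ suc a) (funToFin {suc a} (const c₀)))
  rest = proj₂ (prefix-determined GR a M (r ^ suc a) (funToFin {suc a} (const c₀)))
  N = proj₁ (GR (suc a) M′ r c₀)
  ramsey = proj₂ (GR (suc a) M′ r c₀)

-- For `Total` the space property identifies all lists of one length, so the list of zeros
-- represents each length; short lists are included, hence one `w` serves all lengths.
level-determined : ∀ a d r → ∃ λ N → ∀ (χ : List (Fin (suc a)) → Fin r) →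
  Σ (ℕ → Fin r) λ c → Σ (Word (suc a) N d) λ w → ∀ p → χ (w ⟦ p ⟧) ≡ c (length p)
level-determined a d r = proj₁ space , λ χ →
  let w , mono = proj₂ space χ
  in (λ l → χ (w ⟦ replicate l zero ⟧)) , w , λ p → mono p _ (replicate-total zero p)
  where space = line⇒space (hales-jewett (suc a)) d r

graham-rothschild : ∀ k → GrahamRothschild k
graham-rothschild zero a m r c₀ = proj₁ space , λ χ →
  -- A word without parameters is its own prefix, of full length `m`, so a colour depending on the
  -- level is constant.
  let c , w , mono = proj₂ space (χ ∘ fromList _ zero)
  in c m , w , λ v → begin
      χ (v ⊙ w)                                ≡⟨ cong χ (fromList-prefix zero (v ⊙ w)) ⟨
      χ (fromList _ zero (prefix (v ⊙ w)))     ≡⟨ cong (χ ∘ fromList _ zero) (prefix-subst id w v) ⟩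
      χ (fromList _ zero (w ⟦ prefix v ⟧))     ≡⟨ mono (prefix v) ⟩
      c (level v)                              ≡⟨ cong c (length-prefix v) ⟩
      c m                                      ∎
  where
  open ≡-Reasoning
  space = level-determined a m r
graham-rothschild (suc k) a m r c₀ = proj₁ stable , λ χ →
  let f , w₁ , f-det = proj₂ stable χ
      c , w₂ , c-det = proj₂ space f
      i , w₃ , mono  = monochromatic-levels {suc a} zero M demands refl c
      w₃′ , mono′ = subst
        (λ d → Σ (Word (suc a) M d) λ w → ∀ (v : Word (suc a) d (suc k)) → c (level (v ⊙ w)) ≡ i)
        (lookup-replicate i m) (w₃ , mono)
  in i , w₃′ ⊙ w₂ ⊙ w₁ , λ v → begin
      χ (v ⊙ (w₃′ ⊙ w₂ ⊙ w₁))            ≡⟨ cong χ (subst-assoc id id w₁ (w₃′ ⊙ w₂) v) ⟩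
      χ (v ⊙ (w₃′ ⊙ w₂) ⊙ w₁)            ≡⟨ f-det (v ⊙ (w₃′ ⊙ w₂)) ⟩
      f (prefix (v ⊙ (w₃′ ⊙ w₂)))        ≡⟨ cong (f ∘ prefix) (subst-assoc id id w₂ w₃′ v) ⟩
      f (prefix (v ⊙ w₃′ ⊙ w₂))          ≡⟨ cong f (prefix-subst id w₂ (v ⊙ w₃′)) ⟩
      f (w₂ ⟦ prefix (v ⊙ w₃′) ⟧)        ≡⟨ c-det (prefix (v ⊙ w₃′)) ⟩
      c (level (v ⊙ w₃′))                ≡⟨ mono′ v ⟩
      i                                  ∎
  where
  open ≡-Reasoning
  -- Demanding `m` of every colour leaves `m` parameters whichever colour wins.
  demands = Vec.replicate r m
  M = Vec.sum demands
  space = level-determined a M r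
  stable = prefix-determined (graham-rothschild k) a (proj₁ space) r c₀

-- A nonempty word over `Fin 0` must begin with a parameter; behind it the alphabet has one letter
-- and Graham-Rothschild applies. The given word ensures that `m` and `n` are both zero or both
-- positive.
dual-ramsey : ∀ {m n} → Word 0 m n → ∀ r → Fin r → ∃ λ N → ∀ (χ : Word 0 N n → Fin r) →
  Σ (Word 0 N m) λ w → ∀ v v′ → χ (v ⊙ w) ≡ χ (v′ ⊙ w)
dual-ramsey [] r c₀ = 0 , λ χ → [] , λ { [] [] → refl }
dual-ramsey {suc m} {suc n} (new _) r c₀ = suc (proj₁ gr) , λ χ →
  let c , w , mono = proj₂ gr (χ ∘ new)
      colour : ∀ v → χ (v ⊙ new w) ≡ c
      colour = λ { (new v) → trans (cong (χ ∘ new) (subst-cong lift-id w v)) (mono v) }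
  in new w , λ v v′ → trans (colour v) (sym (colour v′))
  where gr = graham-rothschild n 0 m r c₀

-- Rigid surjections as words

-- Values in an arbitrary `Y` allow a parameter, once met, to continue as a letter with the same
-- value.
eval : ∀ {b n k} {Y : Set} → (Fin b → Y) → (Fin k → Y) → Word b n k → Fin n → Y
eval σ τ (old x w) zero    = σ x
eval σ τ (old x w) (suc t) = eval σ τ w t
eval σ τ (new w)   zero    = τ zero
eval σ τ (new w)   (suc t) = eval (ext σ (τ zero)) (τ ∘ suc) w t

eval-cong : ∀ {b n k} {Y : Set} {σ σ′ : Fin b → Y} {τ τ′ : Fin k → Y} → σ ≗ σ′ → τ ≗ τ′ →
            (w : Word b n k) → eval σ τ w ≗ eval σ′ τ′ w
eval-cong σ≗σ′ τ≗τ′ (old x w) zero    = σ≗σ′ x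
eval-cong σ≗σ′ τ≗τ′ (old x w) (suc t) = eval-cong σ≗σ′ τ≗τ′ w t
eval-cong σ≗σ′ τ≗τ′ (new w)   zero    = τ≗τ′ zero
eval-cong {σ = σ} {σ′} {τ} {τ′} σ≗σ′ τ≗τ′ (new w) (suc t) = eval-cong ext≗ (τ≗τ′ ∘ suc) w t
  where
  ext≗ : ext σ (τ zero) ≗ ext σ′ (τ′ zero)
  ext≗ zero    = τ≗τ′ zero
  ext≗ (suc x) = σ≗σ′ x

eval-map : ∀ {b n k} {Y Z : Set} (h : Y → Z) (σ : Fin b → Y) (τ : Fin k → Y) (w : Word b n k) →
           h ∘ eval σ τ w ≗ eval (h ∘ σ) (h ∘ τ) w
eval-map h σ τ (old x w) zero    = refl
eval-map h σ τ (old x w) (suc t) = eval-map h σ τ w t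
eval-map h σ τ (new w)   zero    = refl
eval-map h σ τ (new w)   (suc t) =
  trans (eval-map h (ext σ (τ zero)) (τ ∘ suc) w t) (eval-cong (∘-ext h σ (τ zero)) (λ _ → refl) w t)

eval-subst : ∀ {a b n m k} {Y : Set} (σ : Fin a → Y) (τ : Fin k → Y) (ρ : Fin b → Fin a)
             (w : Word b n m) (v : Word a m k) →
             eval σ τ (subst-word ρ w v) ≗ eval (σ ∘ ρ) (eval σ τ v) w
eval-subst σ τ ρ (old x w) v         zero    = refl
eval-subst σ τ ρ (old x w) v         (suc t) = eval-subst σ τ ρ w v t
eval-subst σ τ ρ (new w)   (old y v) zero    = refl
eval-subst σ τ ρ (new w)   (old y v) (suc t) =
  trans (eval-subst σ τ (ext ρ y) w v t) (eval-cong (∘-ext σ ρ y) (λ _ → refl) w t)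
eval-subst σ τ ρ (new w)   (new v)   zero    = refl
eval-subst σ τ ρ (new w)   (new v)   (suc t) =
  trans (eval-subst (ext σ (τ zero)) (τ ∘ suc) (lift ρ) w v t)
        (eval-cong (ext∘lift σ ρ (τ zero)) (λ _ → refl) w t)

param : ∀ {n k} → Word 0 n k → Fin n → Fin k
param = eval (λ ()) id

param-⊙ : ∀ {n m k} (v : Word 0 m k) (w : Word 0 n m) → param (v ⊙ w) ≗ param v ∘ param w
param-⊙ v w t = trans (eval-subst (λ ()) id id w v t)
  (sym (trans (eval-map (param v) (λ ()) id w t) (eval-cong (λ ()) (λ _ → refl) w t)))

eval-surjective : ∀ {b n k} {Y : Set} (σ : Fin b → Y) (τ : Fin k → Y) (w : Word b n k) →
                  ∀ j → ∃ λ t → eval σ τ w t ≡ τ j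
eval-surjective σ τ (old x w) j       = let t , eq = eval-surjective σ τ w j in suc t , eq
eval-surjective σ τ (new w)   zero    = zero , refl
eval-surjective σ τ (new w)   (suc j) =
  let t , eq = eval-surjective (ext σ (τ zero)) (τ ∘ suc) w j in suc t , eq

-- Parameters are introduced in increasing order, so all smaller ones precede any occurrence of `j`.
eval-rigid : ∀ {b n k} {Y : Set} (σ : Fin b → Y) (τ : Fin k → Y) (w : Word b n k) (t : Fin n) →
  (∃ λ x → eval σ τ w t ≡ σ x) ⊎
  (∃ λ j → eval σ τ w t ≡ τ j × (∀ i → i Fin.< j → ∃ λ s → s Fin.< t × eval σ τ w s ≡ τ i))
eval-rigid σ τ (old x w) zero = inj₁ (x , refl)
eval-rigid σ τ (old x w) (suc t) with eval-rigid σ τ w t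
... | inj₁ found = inj₁ found
... | inj₂ (j , eq , earlier) = inj₂ (j , eq , λ i i<j →
  let s , s<t , eq′ = earlier i i<j in suc s , s<s s<t , eq′)
eval-rigid σ τ (new w) zero = inj₂ (zero , refl , λ _ ())
eval-rigid σ τ (new w) (suc t) with eval-rigid (ext σ (τ zero)) (τ ∘ suc) w t
-- In the tail, the letter `zero` is the parameter just introduced.
... | inj₁ (zero  , eq) = inj₂ (zero , eq , λ _ ())
... | inj₁ (suc x , eq) = inj₁ (x , eq)
... | inj₂ (j , eq , earlier) = inj₂ (suc j , eq , λ where
  zero    _         → zero , z<s , refl
  (suc i) (s<s i<j) → let s , s<t , eq′ = earlier i i<j in suc s , s<s s<t , eq′)

param-rigid : ∀ {n k} (w : Word 0 n k) t {i} → i Fin.< param w t → ∃ λ s → s Fin.< t × param w s ≡ i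
param-rigid w t i<t with eval-rigid (λ ()) id w t
... | inj₂ (j , eq , earlier) = earlier _ (subst (_ Fin.<_) eq i<t)

module _ {b n k : ℕ} (h : Fin n → Fin b ⊎ Fin k) where
  Rigid Onto : Set
  Rigid = ∀ t {i j} → h t ≡ inj₂ j → i Fin.< j → ∃ λ s → s Fin.< t × h s ≡ inj₂ i
  Onto  = ∀ j → ∃ λ t → h t ≡ inj₂ j

demote : ∀ {b k} → Fin b ⊎ Fin (suc k) → Fin (suc b) ⊎ Fin k
demote (inj₁ x)       = inj₁ (suc x)
demote (inj₂ zero)    = inj₁ zero
demote (inj₂ (suc j)) = inj₂ j

demote-inj₂ : ∀ {b k} (z : Fin b ⊎ Fin (suc k)) {j} → demote z ≡ inj₂ j → z ≡ inj₂ (suc j)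
demote-inj₂ (inj₂ (suc j)) refl = refl

demote-[,] : ∀ {b k} {Y : Set} (σ : Fin b → Y) (τ : Fin (suc k) → Y) (z : Fin b ⊎ Fin (suc k)) →
             [ ext σ (τ zero) , τ ∘ suc ]′ (demote z) ≡ [ σ , τ ]′ z
demote-[,] σ τ (inj₁ x)       = refl
demote-[,] σ τ (inj₂ zero)    = refl
demote-[,] σ τ (inj₂ (suc j)) = refl

-- Inverts `eval`. Rigidity forces the first value to be a letter or parameter `zero`; in the latter
-- case `demote` turns that parameter into a letter, and the tail is again rigid and onto.
toWord : ∀ {b n k} (h : Fin n → Fin b ⊎ Fin k) → Rigid h → Onto h →
  Σ (Word b n k) λ w → ∀ {Y : Set} (σ : Fin b → Y) (τ : Fin k → Y) t → eval σ τ w t ≡ [ σ , τ ]′ (h t)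
toWord {n = zero} {k = zero}  h rigid onto = [] , λ _ _ ()
toWord {n = zero} {k = suc k} h rigid onto with onto zero
... | () , _
toWord {n = suc n} h rigid onto with h zero in h₀
... | inj₁ x = let w , eq = toWord (h ∘ suc) rigid′ onto′ in
    old x w , λ where
      σ τ zero    → sym (cong [ σ , τ ]′ h₀)
      σ τ (suc t) → eq σ τ t
  where
  rigid′ : Rigid (h ∘ suc)
  rigid′ t ht≡j i<j with rigid (suc t) ht≡j i<j
  ... | zero  , _       , eq with trans (sym h₀) eq
  ...   | ()
  rigid′ t ht≡j i<j | suc s , s<s s<t , eq = s , s<t , eq
  onto′ : Onto (h ∘ suc)
  onto′ j with onto j
  ... | suc t , eq = t , eq
  ... | zero  , eq with trans (sym h₀) eq
  ...   | ()
... | inj₂ (suc j) with rigid zero h₀ (z<s {n = toℕ j})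
...   | ()
toWord {k = suc k} h rigid onto | inj₂ zero = let w , eq = toWord (demote ∘ h ∘ suc) rigid′ onto′ in
    new w , λ where
      σ τ zero    → sym (cong [ σ , τ ]′ h₀)
      σ τ (suc t) → trans (eq _ _ t) (demote-[,] σ τ (h (suc t)))
  where
  rigid′ : Rigid (demote ∘ h ∘ suc)
  rigid′ t ht≡j i<j with rigid (suc t) (demote-inj₂ _ ht≡j) (s<s i<j)
  ... | zero  , _       , eq with trans (sym h₀) eq
  ...   | ()
  rigid′ t ht≡j i<j | suc s , s<s s<t , eq = s , s<t , cong demote eq
  onto′ : Onto (demote ∘ h ∘ suc)
  onto′ j with onto (suc j)
  ... | suc t , eq = t , cong demote eq
  ... | zero  , eq with trans (sym h₀) eq
  ...   | ()

-- Increasing enumerations of finite chains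

record Enumeration (X : Chain) : Set where
  open StrictTotalOrder X
  field
    size     : ℕ
    at       : Fin size → Carrier
    index    : Carrier → Fin size
    at-mono  : ∀ {i j} → i Fin.< j → at i < at j
    at-index : ∀ x → at (index x) ≈ x

  at-reflects-< : ∀ {i j} → at i < at j → i Fin.< j
  at-reflects-< {i} {j} lt with <-cmp i j
  ... | tri< i<j _ _  = i<j
  ... | tri≈ _ refl _ = ⊥-elim (irrefl Eq.refl lt)
  ... | tri> _ _ j<i  = ⊥-elim (asym lt (at-mono j<i))

  at-injective : ∀ {i j} → at i ≈ at j → i ≡ j
  at-injective {i} {j} eq with <-cmp i j
  ... | tri< i<j _ _ = ⊥-elim (irrefl eq (at-mono i<j))
  ... | tri≈ _ i≡j _ = i≡j
  ... | tri> _ _ j<i = ⊥-elim (irrefl (Eq.sym eq) (at-mono j<i))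

module _ (X : Chain) where
  open StrictTotalOrder X

  -- Merging equal elements keeps the list strictly increasing whatever is inserted.
  insert : Carrier → List Carrier → List Carrier
  insert x []       = x ∷ []
  insert x (y ∷ ys) with compare x y
  ... | tri< _ _ _ = x ∷ y ∷ ys
  ... | tri≈ _ _ _ = y ∷ ys
  ... | tri> _ _ _ = y ∷ insert x ys

  insert-All : ∀ {z x ys} → z < x → All (z <_) ys → All (z <_) (insert x ys)
  insert-All                  z<x []           = z<x ∷ []
  insert-All {x = x} {y ∷ ys} z<x (z<y ∷ z<ys) with compare x y
  ... | tri< _ _ _ = z<x ∷ z<y ∷ z<ys
  ... | tri≈ _ _ _ = z<y ∷ z<ys
  ... | tri> _ _ _ = z<y ∷ insert-All z<x z<ys

  insert-AllPairs : ∀ x {ys} → AllPairs _<_ ys → AllPairs _<_ (insert x ys)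
  insert-AllPairs x          []            = [] ∷ []
  insert-AllPairs x {y ∷ ys} (y<ys ∷ sorted) with compare x y
  ... | tri< x<y _ _ = (x<y ∷ All.map (StrictTotalOrder.trans X x<y) y<ys) ∷ y<ys ∷ sorted
  ... | tri≈ _ _ _   = y<ys ∷ sorted
  ... | tri> _ _ y<x = insert-All y<x y<ys ∷ insert-AllPairs x sorted

  ∈-insert-new : ∀ x ys → Any (_≈ x) (insert x ys)
  ∈-insert-new x []       = here Eq.refl
  ∈-insert-new x (y ∷ ys) with compare x y
  ... | tri< _ _ _   = here Eq.refl
  ... | tri≈ _ x≈y _ = here (Eq.sym x≈y)
  ... | tri> _ _ _   = there (∈-insert-new x ys)

  ∈-insert-old : ∀ {z} x {ys} → Any (_≈ z) ys → Any (_≈ z) (insert x ys)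
  ∈-insert-old x {y ∷ ys} z∈ with compare x y
  ... | tri< _ _ _ = there z∈
  ... | tri≈ _ _ _ = z∈
  ∈-insert-old x {y ∷ ys} (here y≈z) | tri> _ _ _ = here y≈z
  ∈-insert-old x {y ∷ ys} (there z∈) | tri> _ _ _ = there (∈-insert-old x z∈)

  lookup-mono : ∀ {xs} → AllPairs _<_ xs → ∀ {i j} → i Fin.< j → List.lookup xs i < List.lookup xs j
  lookup-mono (x<xs ∷ sorted) {zero}  {suc j} _         = All.lookup x<xs (∈-lookup j)
  lookup-mono (x<xs ∷ sorted) {suc i} {suc j} (s<s i<j) = lookup-mono sorted i<j

  enumerate : (xs : List Carrier) → AllPairs _<_ xs → (∀ x → Any (_≈ x) xs) → Enumeration X
  enumerate xs sorted complete = record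
    { size     = length xs
    ; at       = List.lookup xs
    ; index    = λ x → Any.index (complete x)
    ; at-mono  = lookup-mono sorted
    ; at-index = λ x → lookup-index (complete x)
    }

edges : (𝒜 : ExtDigraph) → Enumeration (ExtDigraph.edgeChain 𝒜)
edges 𝒜 = let es , sorted , complete = collect (cartesianProduct vertices vertices) in
  enumerate edgeChain es sorted (λ e → complete e (∈-cartesianProduct⁺ (∈-vertices _) (∈-vertices _)))
  where
  open ExtDigraph 𝒜
  collect : ∀ ps → Σ (List Edge) λ es → AllPairs _⊏sal_ es × (∀ e → proj₁ e ∈ ps → Any (_≈ᴱ e) es)
  collect [] = [] , [] , λ _ ()
  collect ((x , y) ∷ ps) with ρ? x y | collect ps
  ... | no ¬r | es , sorted , complete = es , sorted , λ where
    (_ , r) (here refl) → ⊥-elim (¬r r)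
    e       (there e∈)  → complete e e∈
  ... | yes r | es , sorted , complete =
    insert edgeChain e₀ es , insert-AllPairs edgeChain e₀ sorted , λ where
      (_ , _) (here refl) → ∈-insert-new edgeChain e₀ es
      e       (there e∈)  → ∈-insert-old edgeChain {e} e₀ (complete e e∈)
    where
    e₀ : Edge
    e₀ = (x , y) , r

-- The poset of disjoint edges

module _ (N : ℕ) where
  _⊏ᴺ_ : Fin N × Bool → Fin N × Bool → Set
  _⊏ᴺ_ = ×-Lex _≡_ Fin._<_ Bool._<_

  ⊏ᴺ-compare : Trichotomous _≡_ _⊏ᴺ_
  ⊏ᴺ-compare p q with ×-compare sym <-cmp Bool.<-cmp p q
  ... | tri< lt ne gt = tri< lt (ne ∘ ≡⇒≡×≡) gt
  ... | tri≈ lt eq gt = tri≈ lt (≡×≡⇒≡ eq) gt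
  ... | tri> lt ne gt = tri> lt (ne ∘ ≡⇒≡×≡) gt

  disjointEdges : ExtDigraph
  disjointEdges = record
    { Carrier            = Fin N × Bool
    ; size               = N ℕ.* 2
    ; finite             = ↔-sym (↔-trans *↔× (↔-refl ×-↔ 2↔Bool))
    ; ρ                  = λ (x , s) (y , t) → x ≡ y × s Bool.≤ t
    ; ρ?                 = λ (x , s) (y , t) → (x ≟ y) ×-dec (s Bool.≤? t)
    ; ρ-refl             = refl , b≤b
    ; _⊏_                = _⊏ᴺ_
    ; isStrictTotalOrder = isStrictTotalOrderᶜ record
      { isEquivalence = isEquivalence
      ; trans         = ×-transitive {_<₂_ = Bool._<_} isEquivalence (resp₂ Fin._<_) <-trans Bool.<-trans
      ; compare       = ⊏ᴺ-compare
      }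
    ; extends            = λ where
        (refl , f≤t) _  → inj₂ (refl , Bool.f<t)
        (refl , b≤b) ne → ⊥-elim (ne refl)
    }

  disjointEdgesPoset : ExtPoset
  disjointEdgesPoset = record
    { digraph        = disjointEdges
    ; isPartialOrder = record
      { isPreorder = record
        { isEquivalence = isEquivalence
        ; reflexive     = λ { refl → refl , b≤b }
        ; trans         = λ (x≡y , s≤t) (y≡z , t≤u) → trans x≡y y≡z , Bool.≤-trans s≤t t≤u
        }
      ; antisym = λ (x≡y , s≤t) (_ , t≤s) → cong₂ _,_ x≡y (Bool.≤-antisym s≤t t≤s)
      }
    }

-- Strong rigid quotient maps from words

module Quotient (𝒜 : ExtDigraph) where
  open ExtDigraph 𝒜
  open Enumeration (edges 𝒜) public renaming (size to edgeCount)

  end : Edge → Bool → Carrier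
  end e false = src e
  end e true  = tgt e

  loop : Carrier → Edge
  loop a = (a , a) , ρ-refl

  -- A proper edge comes after all loops, and a loop is the loop at each of its ends.
  loop-end⊑ : ∀ e s → loop (end e s) ⊏sal e ⊎ loop (end e s) ≈ᴱ e
  loop-end⊑ e s with loop? e
  loop-end⊑ e s     | no ¬l = inj₁ (loop<nonloop refl ¬l)
  loop-end⊑ e false | yes l = inj₂ (cong (src e ,_) l)
  loop-end⊑ e true  | yes l = inj₂ (cong (_, tgt e) (sym l))

  below-loop : ∀ {p q} → p ⊏sal q → IsLoop q → IsLoop p
  below-loop (loop<nonloop l _) _ = l
  below-loop (loops l _ _)      _ = l
  below-loop (nonloops _ n _)   l = ⊥-elim (n l)

  module _ {N : ℕ} (w : Word 0 N edgeCount) where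
    private
      module C = ExtDigraph (disjointEdges N)

    edgeOf : Fin N → Edge
    edgeOf x = at (param w x)

    vertexMap : C.Carrier → Carrier
    vertexMap (x , s) = end (edgeOf x) s

    vertexMap-hom : IsHomomorphism (disjointEdges N) 𝒜 vertexMap
    vertexMap-hom {x , _} (refl , f≤t) = proj₂ (edgeOf x)
    vertexMap-hom         (refl , b≤b) = ρ-refl

    edgeMap : C.Edge → Edge
    edgeMap = induced (disjointEdges N) 𝒜 vertexMap vertexMap-hom

    -- Since `at` is increasing, `e` has a smaller index than the label of `x`, and rigidity of `w`
    -- puts that index at an earlier place.
    base : ∀ {x e} → e ⊏sal edgeOf x → ∃ λ y → y Fin.< x × edgeOf y ≈ᴱ e
    base {x} {e} e<x
      with param-rigid w x
             (at-reflects-< (sal-respˡ {edgeOf x} {e} {at (index e)} (sym (at-index e)) e<x))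
    ... | y , y<x , eq = y , y<x , trans (cong (proj₁ ∘ at) eq) (at-index e)

    -- Gives rigidity without computing minima. The edge `d` has the same kind as `c`, loop or
    -- proper, so `⊏sal` compares the two by their places.
    edgeMap-earlier : ∀ c {e} → e ⊏sal edgeMap c → ∃ λ d → d C.⊏sal c × edgeMap d ≈ᴱ e
    edgeMap-earlier (((x , _) , (_ , _)) , (refl , f≤t)) {e} e<c =
      let y , y<x , eq = base {x} {e} (sal-respʳ {e} {_} {edgeOf x} refl e<c)
      in (((y , false) , (y , true)) , (refl , f≤t))
       , C.lex⇒sal _ _ (inj₂ ((λ ()) , (λ ()))) (inj₁ (inj₁ y<x))
       , eq
    -- The image of `c` is a loop not above the label of `x`. Being below a loop, `e` is a loop too,
    -- so the loop at `(y , false)` is mapped to it.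
    edgeMap-earlier (((x , s) , (_ , _)) , (refl , b≤b)) {e} e<c =
      let y , y<x , eq = base {x} {e} (e<x (loop-end⊑ (edgeOf x) s))
      in (((y , false) , (y , false)) , (refl , b≤b))
       , C.lex⇒sal _ _ (inj₁ (refl , refl)) (inj₁ (inj₁ y<x))
       , trans (cong (src (edgeOf y) ,_)
                 (trans (cong proj₁ eq) (trans (below-loop e<c refl) (sym (cong proj₂ eq))))) eq
      where
      c : Edge
      c = loop (end (edgeOf x) s)
      e<x : c ⊏sal edgeOf x ⊎ c ≈ᴱ edgeOf x → e ⊏sal edgeOf x
      e<x (inj₁ c<x) = sal-trans e<c c<x
      e<x (inj₂ c≈x) = sal-respʳ {e} {c} {edgeOf x} c≈x e<c

    quotientMap : StrongRigidQuotientMap (disjointEdges N) 𝒜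
    quotientMap = record
      { fun            = vertexMap
      ; isHomomorphism = vertexMap-hom
      ; inducedIsRigid = record
        { isSurjection = record
          { isCongruent = record
            { cong           = λ {refl → refl}
            ; isEquivalence₁ = StrictTotalOrder.isEquivalence C.edgeChain
            ; isEquivalence₂ = StrictTotalOrder.isEquivalence edgeChain
            }
          ; surjective = λ e → let x , eq = eval-surjective (λ ()) id w (index e) in
              (((x , false) , (x , true)) , (refl , f≤t)) ,
              λ { refl → trans (cong (proj₁ ∘ at) eq) (at-index e) }
          }
        -- The edge `e` is hit at some `d` before `n`, and the least preimage `m` is at most `d`.
        ; rigid = λ {e} {e′} e<e′ {m} {n} (_ , m-least) (fn≈e′ , _) →
            let d , d<n , fd≈e = edgeMap-earlier n {e} (sal-respʳ {e} {e′} {edgeMap n} (sym fn≈e′) e<e′)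
            in [ (λ m<d → C.sal-trans m<d d<n) , (λ m≈d → C.sal-respˡ {n} {d} {m} (sym m≈d) d<n) ]′
                 (m-least d fd≈e)
        }
      }

-- The word of a strong rigid quotient map

module _ {𝒜 ℬ : ExtDigraph} (f : StrongRigidQuotientMap ℬ 𝒜) where
  private
    module A = ExtDigraph 𝒜
    module B = ExtDigraph ℬ
    module QA = Quotient 𝒜
    module QB = Quotient ℬ
    open StrongRigidQuotientMap f
    module F = IsRigidSurjection inducedIsRigid

    f̂ : B.Edge → A.Edge
    f̂ = induced ℬ 𝒜 fun isHomomorphism

    indexMap : Fin QB.edgeCount → Fin QA.edgeCount
    indexMap i = QA.index (f̂ (QB.at i))

    at-indexMap : ∀ {i e} → QB.at i B.≈ᴱ e → QA.at (indexMap i) A.≈ᴱ f̂ e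
    at-indexMap {i} {e} eq = trans (QA.at-index (f̂ (QB.at i))) (F.cong {QB.at i} {e} eq)

    min-fibre : ∀ e → ∃ (IsMin B.edgeChain (F.fibre e))
    min-fibre e = B.edge-minima (F.fibre e) (λ x → StrictTotalOrder._≟_ A.edgeChain (f̂ x) e)
      (λ {x} {y} x≈y fx≈e → trans (sym (F.cong {x} {y} x≈y)) fx≈e) (F.strictlySurjective e)

    index-of : ∀ {d j} → f̂ d A.≈ᴱ QA.at j → indexMap (QB.index d) ≡ j
    index-of {d} {j} eq = QA.at-injective (trans (at-indexMap {QB.index d} {d} (QB.at-index d)) eq)

    indexMap-onto : ∀ j → ∃ λ t → indexMap t ≡ j
    indexMap-onto j = let d , eq = F.strictlySurjective (QA.at j) in QB.index d , index-of {d} eq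

    -- The least preimage of `QA.at i` precedes that of `f̂ (QB.at t)`, and the latter is at most
    -- `QB.at t`.
    indexMap-rigid : ∀ t {i} → i Fin.< indexMap t → ∃ λ s → s Fin.< t × indexMap s ≡ i
    indexMap-rigid t {i} i<ht = go (min-fibre (QA.at i)) (min-fibre (f̂ (QB.at t)))
      where
      i<t : QA.at i A.⊏sal f̂ (QB.at t)
      i<t = A.sal-respʳ {QA.at i} {QA.at (indexMap t)} {f̂ (QB.at t)} (QA.at-index _) (QA.at-mono i<ht)
      go : ∃ (IsMin B.edgeChain (F.fibre (QA.at i))) → ∃ (IsMin B.edgeChain (F.fibre (f̂ (QB.at t)))) →
           ∃ λ s → s Fin.< t × indexMap s ≡ i
      go (d , dmin) (d′ , d′min@(_ , least)) =
        QB.index d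
        , QB.at-reflects-<
            (B.sal-respˡ {QB.at t} {d} {QB.at (QB.index d)} (sym (QB.at-index d)) (d<t (least (QB.at t) refl)))
        , index-of {d} (proj₁ dmin)
        where
        d<d′ : d B.⊏sal d′
        d<d′ = F.rigid i<t dmin d′min
        d<t : d′ B.⊏sal QB.at t ⊎ d′ B.≈ᴱ QB.at t → d B.⊏sal QB.at t
        d<t (inj₁ lt) = B.sal-trans d<d′ lt
        d<t (inj₂ eq) = B.sal-respʳ {d} {d′} {QB.at t} eq d<d′

    edgeWord-spec : Σ (Word 0 QB.edgeCount QA.edgeCount) λ w →
      ∀ {Y : Set} σ (τ : _ → Y) t → eval σ τ w t ≡ τ (indexMap t)
    edgeWord-spec = toWord (inj₂ ∘ indexMap)
      (λ { t refl i<j → let s , s<t , eq = indexMap-rigid t i<j in s , s<t , cong inj₂ eq })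
      (λ j → let t , eq = indexMap-onto j in t , cong inj₂ eq)

  edgeWord : Word 0 QB.edgeCount QA.edgeCount
  edgeWord = proj₁ edgeWord-spec

  edgeWord-at : ∀ t → proj₁ (QA.at (param edgeWord t)) ≡ proj₁ (f̂ (QB.at t))
  edgeWord-at t = trans (cong (proj₁ ∘ QA.at) (proj₂ edgeWord-spec (λ ()) id t)) (QA.at-index _)

  -- Lets a colouring of quotient maps be pulled back to words: by `param-⊙`, both sides read the
  -- same endpoint of the same edge.
  quotientMap-∘ : ∀ {N} (w : Word 0 N QB.edgeCount) x →
    fun (QB.vertexMap w x) ≡ QA.vertexMap (edgeWord ⊙ w) x
  quotientMap-∘ w (x , false) =
    sym (trans (cong (A.src ∘ QA.at) (param-⊙ edgeWord w x)) (cong proj₁ (edgeWord-at (param w x))))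
  quotientMap-∘ w (x , true) =
    sym (trans (cong (A.tgt ∘ QA.at) (param-⊙ edgeWord w x)) (cong proj₂ (edgeWord-at (param w x))))

-- Transfer of the Ramsey property to digraphs and posets

open Category EDigsrq

disjointEdges-ramsey : ∀ k → 2 ℕ.≤ k → ∀ 𝒜 ℬ → Hom ℬ 𝒜 →
  ∃ λ N → ∀ (χ : Func (homSetoid (disjointEdges N) 𝒜) (setoid (Fin k))) →
    Σ (Hom (disjointEdges N) ℬ) λ w → ∀ (f g : Hom ℬ 𝒜) → χ ⟨$⟩ (f · w) ≡ χ ⟨$⟩ (g · w)
disjointEdges-ramsey (suc k) _ 𝒜 ℬ f₀ = proj₁ ramsey , λ χ →
  let w , mono = proj₂ ramsey (λ v → χ ⟨$⟩ QA.quotientMap v)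
      colour : ∀ f → χ ⟨$⟩ (f · QB.quotientMap w) ≡ χ ⟨$⟩ QA.quotientMap (edgeWord f ⊙ w)
      colour f = Func.cong χ {f · QB.quotientMap w} {QA.quotientMap (edgeWord f ⊙ w)} (quotientMap-∘ f w)
  in QB.quotientMap w , λ f g → trans (colour f) (trans (mono _ _) (sym (colour g)))
  where
  module QA = Quotient 𝒜
  module QB = Quotient ℬ
  ramsey = dual-ramsey (edgeWord f₀) (suc k) zero

corollary5p5 : HasDualRamseyProperty EDigsrq × HasDualRamseyProperty EPossrq
corollary5p5 =
  (λ k 2≤k 𝒜 ℬ f → let N , ramsey = disjointEdges-ramsey k 2≤k 𝒜 ℬ f in disjointEdges N , ramsey) ,
  -- Posets form a full subcategory, and the witness for digraphs is already a poset.
  (λ k 2≤k 𝒜 ℬ f →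
    let N , ramsey = disjointEdges-ramsey k 2≤k (ExtPoset.digraph 𝒜) (ExtPoset.digraph ℬ) f
    in disjointEdgesPoset N , ramsey)
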